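{- Let $w,v\in L\setminus K$ with $\mathrm{tr}_{K|\mathbb{F}_2}(1/\tau(w))=\mathrm{tr}_{K|\mathbb{F}_2}(1/\tau(v))=0$. Then $B_q(w)$ is isotopic to $B_q(v)$ if and only if $v=\phi(w)$ for some field automorphism $\phi$ of $L=\mathbb{F}_{q^2}$. The order of the autotopism group of $B_q(w)$ is $2\iota(q^2-1)^2$, where $\iota$ is the order of the stabilizer of $w$ in the Galois group of $L$ over $\mathbb{F}_2$.
   Context: Let $s\ge1$, $q=2^s$, $K=\mathbb{F}_q\subset L=\mathbb{F}_{q^2}$, $\tau:L\to K$, $\tau(u)=u+u^q$, the trace, and $\mathrm{tr}_{K|\mathbb{F}_2}$ the absolute trace of $K$. For $w\in L\setminus K$ with $\mathrm{tr}_{K|\mathbb{F}_2}(1/\tau(w))=0$, $B_q(w)$ is the semifield on $L\times L$ with multiplication $$(a,b)\star(c,d)=(ac+bd^q+wb^qd,\ a^qd+bc).$$ Two (pre)semifields $(F,+,*)$ and $(F,+,\circ)$ are isotopic if there are additive bijections $\alpha_1,\alpha_2,\beta$ of $F$ with $\beta(\alpha_1(x)*\alpha_2(y))=x\circ y$ for all $x,y$; such a triple $(\alpha_1,\alpha_2,\beta)$ is an isotopy, and an autotopism of $(F,+,*)$ is an isotopy from $(F,+,*)$ to itself. The autotopisms form the autotopism group. -}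

module Defs where

open import Algebra.Apartness.Bundles using (HeytingField; HeytingCommutativeRing)
open import Algebra.Bundles using (AbelianGroup; CommutativeRing; Group)
import Algebra.Construct.DirectProduct as DirectProduct
open import Algebra.Core using (Op₂)
open import Algebra.Definitions using (Congruent₂)
open import Algebra.Morphism.Structures
  using (IsMagmaIsomorphism; IsRingIsomorphism)
import Algebra.Morphism.Construct.Composition as Compose
import Algebra.Morphism.Construct.Identity as Identity
import Algebra.Properties.Semiring.Exp as Exp
import Algebra.Properties.Semiring.Sum as Sum
open import Data.Fin.Base using (Fin; toℕ)
open import Data.Nat.Base as ℕ using (ℕ)
open import Data.Product.Base using (∃; _×_; _,_; proj₁; proj₂)
open import Function.Bundles using (Inverse)
open import Function.Definitions using (Congruent; Injective; Surjective)
open import Level using (Level; _⊔_)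
open import Relation.Binary.Bundles using (Setoid)
import Relation.Binary.Construct.On as On
import Relation.Binary.PropositionalEquality.Properties as ≡
open import Relation.Binary.Definitions using (_Respects_)
open import Relation.Unary using (Pred; _∈_; _∉_)

HasOrder : ∀ {a ℓ : Level} → Setoid a ℓ → ℕ → Set (a ⊔ ℓ)
HasOrder S n = Inverse S (≡.setoid (Fin n))

subset : ∀ {a ℓ p : Level} (S : Setoid a ℓ) → Pred (Setoid.Carrier S) p → Setoid (a ⊔ p) ℓ
subset S P = On.setoid S (proj₁ {B = P})

private
  module Invert {a ℓ : Level} (S : Setoid a ℓ)
    {f : Setoid.Carrier S → Setoid.Carrier S}
    (f-cong : Congruent (Setoid._≈_ S) (Setoid._≈_ S) f)
    (f-inj : Injective (Setoid._≈_ S) (Setoid._≈_ S) f)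
    (f-surj : Surjective (Setoid._≈_ S) (Setoid._≈_ S) f) where

    open Setoid S

    f⁻¹ : Carrier → Carrier
    f⁻¹ y = proj₁ (f-surj y)

    f∘f⁻¹ : ∀ y → f (f⁻¹ y) ≈ y
    f∘f⁻¹ y = proj₂ (f-surj y) refl

    f⁻¹∘f : ∀ x → f⁻¹ (f x) ≈ x
    f⁻¹∘f x = f-inj (f∘f⁻¹ (f x))

    f⁻¹-cong : Congruent _≈_ _≈_ f⁻¹
    f⁻¹-cong {x} {y} x≈y = f-inj (trans (f∘f⁻¹ x) (trans x≈y (sym (f∘f⁻¹ y))))

    f⁻¹-inj : Injective _≈_ _≈_ f⁻¹
    f⁻¹-inj {x} {y} eq = trans (sym (f∘f⁻¹ x)) (trans (f-cong eq) (f∘f⁻¹ y))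

    f⁻¹-surj : Surjective _≈_ _≈_ f⁻¹
    f⁻¹-surj x = f x , λ z≈fx → trans (f⁻¹-cong z≈fx) (f⁻¹∘f x)

module Isotopism {c ℓ : Level} (F : AbelianGroup c ℓ) where

  open AbelianGroup F
    renaming (_∙_ to _+_; ∙-cong to +-cong)

  record AdditiveBijection : Set (c ⊔ ℓ) where
    field
      ⟦_⟧                : Carrier → Carrier
      isMagmaIsomorphism : IsMagmaIsomorphism rawMagma rawMagma ⟦_⟧

    open IsMagmaIsomorphism isMagmaIsomorphism public
      using (homo; injective; surjective) renaming (⟦⟧-cong to cong)

  open AdditiveBijection using (⟦_⟧)

  record Isotopy (_*_ _∘′_ : Op₂ Carrier) : Set (c ⊔ ℓ) where
    field
      α₁ α₂ β : AdditiveBijection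
      isotopy : ∀ x y → ⟦ β ⟧ (⟦ α₁ ⟧ x * ⟦ α₂ ⟧ y) ≈ (x ∘′ y)

  Isotopic : (_*_ _∘′_ : Op₂ Carrier) → Set (c ⊔ ℓ)
  Isotopic = Isotopy

  idᵇ : AdditiveBijection
  idᵇ = record { isMagmaIsomorphism = Identity.isMagmaIsomorphism rawMagma refl }

  infixr 9 _∘ᵇ_
  _∘ᵇ_ : Op₂ AdditiveBijection
  g ∘ᵇ f = record
    { isMagmaIsomorphism = Compose.isMagmaIsomorphism trans
        (AdditiveBijection.isMagmaIsomorphism f)
        (AdditiveBijection.isMagmaIsomorphism g)
    }

  infix 10 _⁻¹ᵇ
  _⁻¹ᵇ : AdditiveBijection → AdditiveBijection
  f ⁻¹ᵇ = record
    { ⟦_⟧ = f⁻¹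
    ; isMagmaIsomorphism = record
      { isMagmaMonomorphism = record
        { isMagmaHomomorphism = record
          { isRelHomomorphism = record { cong = f⁻¹-cong }
          ; homo = λ x y → f.injective (trans (f∘f⁻¹ (x + y)) (sym
              (trans (f.homo (f⁻¹ x) (f⁻¹ y)) (+-cong (f∘f⁻¹ x) (f∘f⁻¹ y)))))
          }
        ; injective = f⁻¹-inj
        }
      ; surjective = f⁻¹-surj
      }
    }
    where
    module f = AdditiveBijection f
    open Invert setoid f.cong f.injective f.surjective

  private
    right-inverse : ∀ f x → ⟦ f ⟧ (⟦ f ⁻¹ᵇ ⟧ x) ≈ x
    right-inverse f x = proj₂ (AdditiveBijection.surjective f x) refl

    left-inverse : ∀ f x → ⟦ f ⁻¹ᵇ ⟧ (⟦ f ⟧ x) ≈ x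
    left-inverse f x = AdditiveBijection.injective f (right-inverse f (⟦ f ⟧ x))

  infix 4 _≗ᵇ_
  _≗ᵇ_ : AdditiveBijection → AdditiveBijection → Set (c ⊔ ℓ)
  f ≗ᵇ g = ∀ x → ⟦ f ⟧ x ≈ ⟦ g ⟧ x

  private
    ⁻¹ᵇ-cong : ∀ f g → f ≗ᵇ g → f ⁻¹ᵇ ≗ᵇ g ⁻¹ᵇ
    ⁻¹ᵇ-cong f g p x = AdditiveBijection.injective f
      (trans (right-inverse f x)
      (trans (sym (right-inverse g x)) (sym (p (⟦ g ⁻¹ᵇ ⟧ x)))))

  -- Since β is applied outside the product, it composes in the order opposite
  -- to α₁ and α₂.
  autotopismGroup : (_*_ : Op₂ Carrier) → Congruent₂ _≈_ _*_ → Group (c ⊔ ℓ) (c ⊔ ℓ)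
  autotopismGroup _*_ *-cong = record
    { Carrier = Isotopy _*_ _*_
    ; _≈_ = λ f g → α₁ f ≗ᵇ α₁ g × α₂ f ≗ᵇ α₂ g × β f ≗ᵇ β g
    ; _∙_ = λ f g → record
      { α₁ = α₁ f ∘ᵇ α₁ g
      ; α₂ = α₂ f ∘ᵇ α₂ g
      ; β = β g ∘ᵇ β f
      ; isotopy = λ x y →
          trans (cong (β g) (isotopy f (⟦ α₁ g ⟧ x) (⟦ α₂ g ⟧ y))) (isotopy g x y)
      }
    ; ε = record { α₁ = idᵇ ; α₂ = idᵇ ; β = idᵇ ; isotopy = λ _ _ → refl }
    ; _⁻¹ = λ f → record
      { α₁ = α₁ f ⁻¹ᵇ
      ; α₂ = α₂ f ⁻¹ᵇ
      ; β = β f ⁻¹ᵇ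
      ; isotopy = λ x y → AdditiveBijection.injective (β f)
          (trans (right-inverse (β f) (⟦ α₁ f ⁻¹ᵇ ⟧ x * ⟦ α₂ f ⁻¹ᵇ ⟧ y))
          (trans (sym (isotopy f (⟦ α₁ f ⁻¹ᵇ ⟧ x) (⟦ α₂ f ⁻¹ᵇ ⟧ y)))
            (cong (β f)
              (*-cong (right-inverse (α₁ f) x) (right-inverse (α₂ f) y)))))
      }
    ; isGroup = record
      { isMonoid = record
        { isSemigroup = record
          { isMagma = record
            { isEquivalence = record
              { refl = (λ _ → refl) , (λ _ → refl) , (λ _ → refl)
              ; sym = λ (p , q , r) →
                  (λ x → sym (p x)) , (λ x → sym (q x)) , (λ x → sym (r x))
              ; trans = λ (p , q , r) (p′ , q′ , r′) →
                  (λ x → trans (p x) (p′ x)) ,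
                  (λ x → trans (q x) (q′ x)) ,
                  (λ x → trans (r x) (r′ x))
              }
            ; ∙-cong = λ {f} {f′} {g} {g′} (p , q , r) (p′ , q′ , r′) →
                (λ x → trans (cong (α₁ f) (p′ x)) (p (⟦ α₁ g′ ⟧ x))) ,
                (λ x → trans (cong (α₂ f) (q′ x)) (q (⟦ α₂ g′ ⟧ x))) ,
                (λ x → trans (cong (β g) (r x)) (r′ (⟦ β f′ ⟧ x)))
            }
          ; assoc = λ _ _ _ → (λ _ → refl) , (λ _ → refl) , (λ _ → refl)
          }
        ; identity = (λ _ → (λ _ → refl) , (λ _ → refl) , (λ _ → refl))
                   , (λ _ → (λ _ → refl) , (λ _ → refl) , (λ _ → refl))
        }
      ; inverse =
            (λ f → left-inverse (α₁ f) , left-inverse (α₂ f) , right-inverse (β f))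
          , (λ f → right-inverse (α₁ f) , right-inverse (α₂ f) , left-inverse (β f))
      ; ⁻¹-cong = λ {f} {g} (p , q , r) →
            ⁻¹ᵇ-cong (α₁ f) (α₁ g) p , ⁻¹ᵇ-cong (α₂ f) (α₂ g) q , ⁻¹ᵇ-cong (β f) (β g) r
      }
    }
    where
    open Isotopy
    open AdditiveBijection using (cong)

-- The prime field is fixed by every ring automorphism, so for a finite field of
-- characteristic p the group below is the Galois group over the field of p elements.
module Automorphisms {c ℓ : Level} (R : CommutativeRing c ℓ) where

  open CommutativeRing R

  record Automorphism : Set (c ⊔ ℓ) where
    field
      ⟦_⟧               : Carrier → Carrier
      isRingIsomorphism : IsRingIsomorphism rawRing rawRing ⟦_⟧

    open IsRingIsomorphism isRingIsomorphism public
      using (+-homo; *-homo; 0#-homo; 1#-homo; -‿homo; injective; surjective)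
      renaming (⟦⟧-cong to cong)

  open Automorphism using (⟦_⟧; cong)

  private
    inverse : Automorphism → Automorphism
    inverse f = record
      { ⟦_⟧ = f⁻¹
      ; isRingIsomorphism = record
        { isRingMonomorphism = record
          { isRingHomomorphism = record
            { isSemiringHomomorphism = record
              { isNearSemiringHomomorphism = record
                { +-isMonoidHomomorphism = record
                  { isMagmaHomomorphism = record
                    { isRelHomomorphism = record { cong = f⁻¹-cong }
                    ; homo = λ x y → f.injective (trans (f∘f⁻¹ (x + y)) (sym
                        (trans (f.+-homo (f⁻¹ x) (f⁻¹ y)) (+-cong (f∘f⁻¹ x) (f∘f⁻¹ y)))))
                    }
                  ; ε-homo = f.injective (trans (f∘f⁻¹ 0#) (sym f.0#-homo))
                  }
                ; *-homo = λ x y → f.injective (trans (f∘f⁻¹ (x * y)) (sym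
                    (trans (f.*-homo (f⁻¹ x) (f⁻¹ y)) (*-cong (f∘f⁻¹ x) (f∘f⁻¹ y)))))
                }
              ; 1#-homo = f.injective (trans (f∘f⁻¹ 1#) (sym f.1#-homo))
              }
            ; -‿homo = λ x → f.injective (trans (f∘f⁻¹ (- x)) (sym
                (trans (f.-‿homo (f⁻¹ x)) (-‿cong (f∘f⁻¹ x)))))
            }
          ; injective = f⁻¹-inj
          }
        ; surjective = f⁻¹-surj
        }
      }
      where
      module f = Automorphism f
      open Invert setoid f.cong f.injective f.surjective

    right-inverse : ∀ f x → ⟦ f ⟧ (⟦ inverse f ⟧ x) ≈ x
    right-inverse f x = proj₂ (Automorphism.surjective f x) refl

    left-inverse : ∀ f x → ⟦ inverse f ⟧ (⟦ f ⟧ x) ≈ x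
    left-inverse f x = Automorphism.injective f (right-inverse f (⟦ f ⟧ x))

  galoisGroup : Group (c ⊔ ℓ) (c ⊔ ℓ)
  galoisGroup = record
    { Carrier = Automorphism
    ; _≈_ = λ f g → ∀ x → ⟦ f ⟧ x ≈ ⟦ g ⟧ x
    ; _∙_ = λ g f → record
      { isRingIsomorphism = Compose.isRingIsomorphism trans
          (Automorphism.isRingIsomorphism f) (Automorphism.isRingIsomorphism g)
      }
    ; ε = record { isRingIsomorphism = Identity.isRingIsomorphism rawRing refl }
    ; _⁻¹ = inverse
    ; isGroup = record
      { isMonoid = record
        { isSemigroup = record
          { isMagma = record
            { isEquivalence = record
              { refl = λ _ → refl
              ; sym = λ p x → sym (p x)
              ; trans = λ p q x → trans (p x) (q x)
              }
            ; ∙-cong = λ {f} {_} {_} {g′} p q x → trans (cong f (q x)) (p (⟦ g′ ⟧ x))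
            }
          ; assoc = λ _ _ _ _ → refl
          }
        ; identity = (λ _ _ → refl) , (λ _ _ → refl)
        }
      ; inverse = left-inverse , right-inverse
      ; ⁻¹-cong = λ {f} {g} p x → Automorphism.injective f
          (trans (right-inverse f x)
          (trans (sym (right-inverse g x)) (sym (p (⟦ inverse g ⟧ x)))))
      }
    }

  stabilizer : Carrier → Setoid (c ⊔ ℓ) (c ⊔ ℓ)
  stabilizer w = subset (Group.setoid galoisGroup) (λ φ → ⟦ φ ⟧ w ≈ w)

module FiniteField {c ℓ₁ ℓ₂ : Level} (L : HeytingField c ℓ₁ ℓ₂) where

  -- On a finite carrier the apartness of a Heyting field is the negation of _≈_,
  -- so finite Heyting fields are finite fields in the usual sense.
  commutativeRing : CommutativeRing c ℓ₁
  commutativeRing =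
    HeytingCommutativeRing.commutativeRing (HeytingField.heytingCommutativeRing L)

  open CommutativeRing commutativeRing public
  open Exp semiring public using (_^_; ^-congˡ)
  open Sum semiring public using (sum)
  open Automorphisms commutativeRing public

  record IsSubfield {ℓ₃ : Level} (K : Pred Carrier ℓ₃) : Set (c ⊔ ℓ₁ ⊔ ℓ₃) where
    field
      respects  : K Respects _≈_
      0∈        : 0# ∈ K
      1∈        : 1# ∈ K
      +-closed  : ∀ {x y} → x ∈ K → y ∈ K → x + y ∈ K
      -‿closed  : ∀ {x} → x ∈ K → - x ∈ K
      *-closed  : ∀ {x y} → x ∈ K → y ∈ K → x * y ∈ K
      ⁻¹-closed : ∀ {x y} → x ∈ K → x * y ≈ 1# → y ∈ K

  -- The trace u + u^q of the quadratic extension L | K, with values in K.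
  τ : (q : ℕ) → Carrier → Carrier
  τ q u = u + u ^ q

  -- The trace from the subfield with 2 ^ s elements to the prime field, as the sum
  -- of the conjugates x ^ (2 ^ i), i < s.
  absoluteTrace : (s : ℕ) → Carrier → Carrier
  absoluteTrace s x = sum {s} (λ i → x ^ (2 ℕ.^ toℕ i))

  -- w ∉ K makes τ(w) nonzero, so t is the unique inverse of τ(w).
  Admissible : {ℓ₃ : Level} (s : ℕ) (K : Pred Carrier ℓ₃) → Carrier → Set (c ⊔ ℓ₁ ⊔ ℓ₃)
  Admissible s K w =
    w ∉ K × ∃ λ t → τ (2 ℕ.^ s) w * t ≈ 1# × absoluteTrace s t ≈ 0#

  L×L : AbelianGroup c ℓ₁
  L×L = DirectProduct.abelianGroup +-abelianGroup +-abelianGroup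

  open Isotopism L×L public using (Isotopic; autotopismGroup)

  -- The multiplication of B_q(w).
  B : (q : ℕ) → Carrier → Op₂ (Carrier × Carrier)
  B q w (a , b) (c , d) =
    (a * c + b * d ^ q + w * b ^ q * d) , (a ^ q * d + b * c)

  B-cong : ∀ q w → Congruent₂ (AbelianGroup._≈_ L×L) (B q w)
  B-cong q w (a≈ , b≈) (c≈ , d≈) =
    +-cong (+-cong (*-cong a≈ c≈) (*-cong b≈ (^-congˡ q d≈)))
           (*-cong (*-congˡ (^-congˡ q b≈)) d≈) ,
    +-cong (*-cong (^-congˡ q a≈) d≈) (*-cong b≈ c≈)

  Autotopisms : (q : ℕ) → Carrier → Group (c ⊔ ℓ₁) (c ⊔ ℓ₁)
  Autotopisms q w = autotopismGroup (B q w) (B-cong q w)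

{-# OPTIONS --safe #-}

-- The middle nucleus of B(w) consists of the pairs (a , 0), so it is L. Hence the maps
-- α₁ and α₂ of an isotopy B(w) → B(v) are semilinear over L for one automorphism φ and
-- are given by 2×2 matrices. Comparing the coefficients of the K-bilinear products
-- leaves eight equations between the entries of the matrices, w and u = φ(v). Extending
-- scalars, the product becomes a four-dimensional space of pairs of 2×2 matrices, on
-- which both determinants are quadratic forms preserved up to a factor. Comparing these
-- forms gives u = w and forces both matrices to be diagonal or both to be antidiagonal.
-- Here N(u) ≠ 1 is needed, and this is what the trace condition provides. The diagonal
-- isotopies are parametrised by two nonzero scalars; the antidiagonal ones differ from
-- these by a fixed twist.

module Submission where

open import Defs
open import Algebra.Apartness.Bundles using (HeytingField)
open import Algebra.Bundles using (AbelianGroup; CommutativeRing; Group)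
import Algebra.Construct.DirectProduct as DirectProduct
open import Algebra.Core using (Op₂)
import Algebra.Properties.CommutativeMonoid.Sum as MonoidSum
import Algebra.Properties.CommutativeSemiring.Exp as CommutativeExp
import Algebra.Properties.Semiring.Mult as Mult
open import Data.Bool.Base using (Bool; true; false; not; if_then_else_; _∧_; _∨_)
import Data.Bool.Properties as Bool
open import Data.Empty using (⊥-elim)
open import Data.Fin.Base using (Fin; zero; suc; toℕ; punchIn; punchOut; combine; finToFun; funToFin)
import Data.Fin.Permutation as Permutation
import Data.Fin.Properties as Fin
open import Data.List.Base using (List; []; _∷_)
import Data.List.Properties as List
open import Data.Nat.Base as ℕ using (ℕ; zero; suc; _<ᵇ_; _≡ᵇ_)
import Data.Nat.Properties as ℕ
open import Data.Product.Base using (∃; _×_; _,_; proj₁; proj₂)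
open import Data.Product.Function.NonDependent.Setoid using (_×-inverse_)
import Data.Product.Properties as Product
open import Data.Product.Relation.Binary.Pointwise.NonDependent using (_×ₛ_; Pointwise-≡↔≡)
open import Data.Sum.Base using (_⊎_; inj₁; inj₂; [_,_]′)
open import Data.Vec.Base using (Vec; []; _∷_)
open import Data.Vec.N-ary using (∀ⁿʰ; curryⁿ)
open import Function.Base using (_∘_; id)
open import Function.Bundles using (Bijection; Inverse; _⇔_; mk⇔)
import Function.Construct.Composition as Compose
import Function.Construct.Identity as Identity
import Function.Construct.Symmetry as Symmetry
open import Function.Definitions using (Congruent; Injective; Surjective)
open import Function.Properties.Bijection using (Bijection⇒Inverse)
open import Level using (Level; _⊔_)
open import Relation.Binary.Bundles using (Setoid)
open import Relation.Binary.Definitions using (Decidable; _Respects_)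
open import Relation.Binary.PropositionalEquality.Core as ≡ using (_≡_)
import Relation.Binary.PropositionalEquality.Properties as ≡
open import Relation.Nullary.Decidable.Core using (Dec; yes; no; map′; _×-dec_)
open import Relation.Nullary.Negation using (¬_; contradiction)
open import Relation.Unary using (Pred)
import Relation.Unary as Unary

-- The product is only K-bilinear, so x and xᶜ are treated as independent coordinates x₁, x₂ (and y,
-- yᶜ as x₃, x₄). The first determinant is then x₁² + wᶜx₁x₂ + x₃x₄ and the second is its conjugate,
-- so the ten coefficients of one form carry all the information. In neither of the pairs (x₁ , x₂),
-- (x₃ , x₄) can the images of X and Y both be nonzero: they would be proportional and Hermitian
-- orthogonal, hence isotropic, and w would be fixed by conjugation. The quantity 1 + N(u) is the
-- determinant of the linear forms x + uᶜy and ux + y, and for u = w its square root ρ enters the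
-- twist; both uses require it to be nonzero. A diagonal autotopism has four scalars, but two of
-- them, P and Q, fix the others through k² = N(P)N(Q), which has exactly one root in characteristic
-- 2. This gives the factor (q² - 1)²; the twist contributes 2 and the automorphisms fixing w
-- contribute ι. The map β adds nothing: (1 , 0) is a left identity, so α₁ and α₂ determine it.

private variable
  a₁ a₂ ℓ₁ ℓ₂ ℓₚ : Level

-- Counting finite setoids

order-× : {S : Setoid a₁ ℓ₁} {T : Setoid a₂ ℓ₂} {m n : ℕ} →
  HasOrder S m → HasOrder T n → HasOrder (S ×ₛ T) (m ℕ.* n)
order-× f g = Compose.inverse (Compose.inverse (f ×-inverse g) Pointwise-≡↔≡) (Symmetry.inverse Fin.*↔×)

-- Pigeonhole: if f missed y, `punchOut` at y would turn it into an injection of `Fin (suc n)` into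
-- `Fin n`.
fin-injective⇒surjective : ∀ {n} (f : Fin n → Fin n) → Injective _≡_ _≡_ f → ∀ y → ∃ λ x → f x ≡ y
fin-injective⇒surjective {suc n} f f-inj y with Fin.any? (λ x → f x Fin.≟ y)
... | yes hit  = hit
... | no  miss = contradiction (Fin.injective⇒≤ {f = g} g-inj) (ℕ.<-irrefl ≡.refl)
  where
  g : Fin (suc n) → Fin n
  g x = punchOut {i = y} {j = f x} (λ e → miss (x , ≡.sym e))
  g-inj : Injective _≡_ _≡_ g
  g-inj e = f-inj (Fin.punchOut-injective {i = y} _ _ e)

decidable-subset-finite : ∀ {n} {P : Pred (Fin n) ℓₚ} → Unary.Decidable P →
  ∃ λ m → HasOrder (subset (≡.setoid (Fin n)) P) m
decidable-subset-finite {n = zero} {P} P? = 0 , record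
  { to = λ ()
  ; from = λ ()
  ; to-cong = λ { {() , _} }
  ; from-cong = λ { {()} }
  ; inverse = (λ { {()} }) , λ { {() , _} }
  }
decidable-subset-finite {n = suc n} {P} P? with decidable-subset-finite {P = P ∘ suc} (P? ∘ suc) | P? zero
... | m , I | no ¬p = m , record
  { to = to′
  ; from = λ j → let (i , q) = from j in suc i , q
  ; to-cong = λ {x} {y} → to-cong′ {x} {y}
  ; from-cong = λ { ≡.refl → ≡.refl }
  ; inverse = (λ { ≡.refl → inverseˡ ≡.refl }) , λ {x} {j} → inv x j
  }
  where
  open Inverse I
  to′ : ∃ P → Fin m
  to′ (zero  , q) = contradiction q ¬p
  to′ (suc i , q) = to (i , q)
  to-cong′ : ∀ {x y} → proj₁ x ≡ proj₁ y → to′ x ≡ to′ y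
  to-cong′ {zero  , q} {_ , _}  _      = contradiction q ¬p
  to-cong′ {suc i , _} {_ , _} ≡.refl = to-cong ≡.refl
  inv : ∀ x j → j ≡ to′ x → suc (proj₁ (from j)) ≡ proj₁ x
  inv (zero  , q) _ _      = contradiction q ¬p
  inv (suc i , q) _ ≡.refl = ≡.cong suc (strictlyInverseʳ (i , q))
... | m , I | yes p = suc m , record
  { to = to′
  ; from = from′
  ; to-cong = λ {x} {y} → to-cong′ {x} {y}
  ; from-cong = λ { ≡.refl → ≡.refl }
  ; inverse = (λ {j} {x} e → ≡.trans (to-cong′ {x} {from′ j} e) (invˡ j)) , λ { {x} ≡.refl → invʳ x }
  }
  where
  open Inverse I
  to′ : ∃ P → Fin (suc m)
  to′ (zero  , q) = zero
  to′ (suc i , q) = suc (to (i , q))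
  from′ : Fin (suc m) → ∃ P
  from′ zero    = zero , p
  from′ (suc j) = let (i , q) = from j in suc i , q
  to-cong′ : ∀ {x y} → proj₁ x ≡ proj₁ y → to′ x ≡ to′ y
  to-cong′ {zero  , _} {_ , _} ≡.refl = ≡.refl
  to-cong′ {suc i , _} {_ , _} ≡.refl = ≡.cong suc (to-cong ≡.refl)
  invˡ : ∀ j → to′ (from′ j) ≡ j
  invˡ zero    = ≡.refl
  invˡ (suc j) = ≡.cong suc (strictlyInverseˡ j)
  invʳ : ∀ x → proj₁ (from′ (to′ x)) ≡ proj₁ x
  invʳ (zero  , _) = ≡.refl
  invʳ (suc i , q) = ≡.cong suc (strictlyInverseʳ (i , q))

-- The image is a decidable subset of `Fin n`, hence countable, and injectivity carries the count
-- back. It serves for automorphisms, coded by their value tables.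
decidable-image⇒finite : {S : Setoid a₁ ℓ₁} {n : ℕ} (code : Setoid.Carrier S → Fin n) →
  Congruent (Setoid._≈_ S) _≡_ code → Injective (Setoid._≈_ S) _≡_ code →
  Unary.Decidable (λ i → ∃ λ x → code x ≡ i) → ∃ (HasOrder S)
decidable-image⇒finite {S = S} {n} code code-cong code-inj image? =
  let (m , I) = decidable-subset-finite image? in m , Compose.inverse J I
  where
  open Setoid S
  J : Inverse S (subset (≡.setoid (Fin n)) (λ i → ∃ λ x → code x ≡ i))
  J = record
    { to = λ x → code x , x , ≡.refl
    ; from = λ (_ , x , _) → x
    ; to-cong = code-cong
    ; from-cong = λ { {_ , _ , e} {_ , _ , e′} i≡j → code-inj (≡.trans e (≡.trans i≡j (≡.sym e′))) }
    ; inverse = (λ { {_ , _ , e} x≈ → ≡.trans (code-cong x≈) e })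
              , (λ { {_} {_ , _ , e} i≡ → code-inj (≡.trans e i≡) })
    }

module FiniteSetoid {S : Setoid a₁ ℓ₁} {n : ℕ} (order : HasOrder S n) where

  open Setoid S
  open Inverse order

  to-injective : ∀ {x y} → to x ≡ to y → x ≈ y
  to-injective {x} {y} e = trans (sym (strictlyInverseʳ x)) (trans (from-cong e) (strictlyInverseʳ y))

  infix 4 _≟_
  _≟_ : Decidable _≈_
  x ≟ y = map′ to-injective to-cong (to x Fin.≟ to y)

  any? : {P : Pred Carrier ℓₚ} → P Respects _≈_ → Unary.Decidable P → Dec (∃ P)
  any? resp P? = map′ (λ (i , q) → from i , q) (λ (x , q) → to x , resp (sym (strictlyInverseʳ x)) q)
    (Fin.any? (P? ∘ from))

  all? : {P : Pred Carrier ℓₚ} → P Respects _≈_ → Unary.Decidable P → Dec (∀ x → P x)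
  all? resp P? = map′ (λ q x → resp (strictlyInverseʳ x) (q (to x))) (λ q i → q (from i))
    (Fin.all? (P? ∘ from))

  injective⇒surjective : ∀ {f} → Congruent _≈_ _≈_ f → Injective _≈_ _≈_ f → Surjective _≈_ _≈_ f
  injective⇒surjective {f} f-cong f-inj y =
    let (i , e) = fin-injective⇒surjective (to ∘ f ∘ from) inj (to y)
    in from i , λ z≈ → trans (f-cong z≈) (to-injective e)
    where
    inj : Injective _≡_ _≡_ (to ∘ f ∘ from)
    inj {i} {j} e = ≡.trans (≡.sym (strictlyInverseˡ i))
      (≡.trans (to-cong (f-inj (to-injective e))) (strictlyInverseˡ j))

order-without : {S : Setoid a₁ ℓ₁} {n : ℕ} → HasOrder S n →
  ∀ x → HasOrder (subset S (λ y → ¬ Setoid._≈_ S y x)) (n ℕ.∸ 1)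
order-without {S = S} {zero} order x with Inverse.to order x
... | ()
order-without {S = S} {suc n} order x = record
  { to = λ (y , y≉x) → punchOut (to-≢ y≉x)
  ; from = λ i → from (punchIn (to x) i) , λ e → Fin.punchInᵢ≢i (to x) i
      (≡.trans (≡.sym (strictlyInverseˡ _)) (to-cong e))
  ; to-cong = λ e → Fin.punchOut-cong (to x) (to-cong e)
  ; from-cong = λ { ≡.refl → refl }
  ; inverse = (λ {i} e → ≡.trans (Fin.punchOut-cong (to x) (≡.trans (to-cong e) (strictlyInverseˡ _)))
                  (Fin.punchOut-punchIn (to x)))
            , (λ { {y , y≉x} ≡.refl → trans (from-cong (Fin.punchIn-punchOut (to-≢ y≉x))) (strictlyInverseʳ y) })
  }
  where
  open Setoid S
  open Inverse order
  open FiniteSetoid order using (to-injective)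
  to-≢ : ∀ {y} → ¬ y ≈ x → ¬ to x ≡ to y
  to-≢ y≉x e = y≉x (to-injective (≡.sym e))

-- Rings of characteristic 2 with an involution

record ConjugationRing (c ℓ : Level) : Set (Level.suc (c ⊔ ℓ)) where
  field
    commutativeRing : CommutativeRing c ℓ

  open CommutativeRing commutativeRing public hiding (zero)

  infix 9 _ᶜ
  field
    1+1≈0    : 1# + 1# ≈ 0#
    _ᶜ       : Carrier → Carrier
    ᶜ-cong   : ∀ {x y} → x ≈ y → x ᶜ ≈ y ᶜ
    ᶜ-+      : ∀ x y → (x + y) ᶜ ≈ x ᶜ + y ᶜ
    ᶜ-*      : ∀ x y → (x * y) ᶜ ≈ x ᶜ * y ᶜ
    1ᶜ≈1     : 1# ᶜ ≈ 1#
    ᶜ-involutive : ∀ x → x ᶜ ᶜ ≈ x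

  x+x≈0 : ∀ x → x + x ≈ 0#
  x+x≈0 x = trans (+-cong (sym (*-identityʳ x)) (sym (*-identityʳ x)))
    (trans (sym (distribˡ x 1# 1#)) (trans (*-congˡ 1+1≈0) (zeroʳ x)))

  x+[x+y]≈y : ∀ x y → x + (x + y) ≈ y
  x+[x+y]≈y x y = trans (sym (+-assoc x x y)) (trans (+-congʳ (x+x≈0 x)) (+-identityˡ y))

  x+y≈0⇒x≈y : ∀ {x y} → x + y ≈ 0# → x ≈ y
  x+y≈0⇒x≈y {x} {y} e =
    trans (sym (+-identityʳ x)) (trans (+-congˡ (sym e)) (x+[x+y]≈y x y))

  x≈y⇒x+y≈0 : ∀ {x y} → x ≈ y → x + y ≈ 0#
  x≈y⇒x+y≈0 {x} {y} e = trans (+-congʳ e) (x+x≈0 y)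

  0ᶜ≈0 : 0# ᶜ ≈ 0#
  0ᶜ≈0 = trans (ᶜ-cong (sym 1+1≈0)) (trans (ᶜ-+ 1# 1#) (trans (+-cong 1ᶜ≈1 1ᶜ≈1) 1+1≈0))

-- Checking ideal membership certificates over F₂

module Solver where

  infixl 6 _+_
  infixl 7 _*_
  infix  9 _ᶜ
  infix  5.8 _≈_
  infix  5.5 _·_
  infix  3 _by_

  data Expr : Set where
    var     : ℕ → Expr
    0# 1#   : Expr
    _+_ _*_ : Expr → Expr → Expr
    _ᶜ      : Expr → Expr

  data Equation : Set where
    _≈_ : Expr → Expr → Equation

  -- The first component is the cofactor of the equation in an ideal membership certificate.
  data Premise : Set where
    _·_ : Expr → Equation → Premise

  record Consequence : Set where
    constructor _by_
    field
      conclusion : Equation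
      premises   : List Premise

  Schema : ℕ → Set
  Schema zero    = Consequence
  Schema (suc n) = Expr → Schema n

  instantiate : ∀ n → Schema n → ℕ → Consequence
  instantiate zero    s k = s
  instantiate (suc n) s k = instantiate n (s (var k)) (suc k)

  -- The Boolean marks a conjugated variable, so x and xᶜ are independent indeterminates.
  -- Coefficients lie in F₂, hence a polynomial is just the list of its monomials.
  Atom Monomial Polynomial : Set
  Atom       = ℕ × Bool
  Monomial   = List Atom
  Polynomial = List Monomial

  _<ᵃ_ : Atom → Atom → Bool
  (i , b) <ᵃ (j , c) = (i <ᵇ j) ∨ ((i ≡ᵇ j) ∧ (not b ∧ c))

  _<ᵐ_ : Monomial → Monomial → Bool
  []       <ᵐ []      = false
  []       <ᵐ (_ ∷ _) = true
  (_ ∷ _)  <ᵐ []      = false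
  (x ∷ xs) <ᵐ (y ∷ ys) = if x <ᵃ y then true else if y <ᵃ x then false else xs <ᵐ ys

  _≟ᵐ_ : (m n : Monomial) → Dec (m ≡ n)
  _≟ᵐ_ = List.≡-dec (Product.≡-dec ℕ._≟_ Bool._≟_)

  insertAtom : Atom → Monomial → Monomial
  insertAtom x []       = x ∷ []
  insertAtom x (y ∷ ys) = if x <ᵃ y then x ∷ y ∷ ys else y ∷ insertAtom x ys

  _·ᵐ_ : Monomial → Monomial → Monomial
  []       ·ᵐ n = n
  (x ∷ xs) ·ᵐ n = insertAtom x (xs ·ᵐ n)

  insert : Monomial → Polynomial → Polynomial
  insert m []      = m ∷ []
  insert m (n ∷ p) with m ≟ᵐ n
  -- Equal monomials cancel because 1 + 1 = 0.
  ... | yes _ = p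
  ... | no  _ = if m <ᵐ n then m ∷ n ∷ p else n ∷ insert m p

  _⊞_ : Polynomial → Polynomial → Polynomial
  []      ⊞ q = q
  (m ∷ p) ⊞ q = insert m (p ⊞ q)

  scale : Monomial → Polynomial → Polynomial
  scale m []      = []
  scale m (n ∷ p) = insert (m ·ᵐ n) (scale m p)

  _⊠_ : Polynomial → Polynomial → Polynomial
  []      ⊠ q = []
  (m ∷ p) ⊠ q = scale m q ⊞ (p ⊠ q)

  -- The flag is the parity of the conjugations still pending. They are pushed down to the
  -- variables, since conjugation is an involution compatible with sums and products.
  normalise : Bool → Expr → Polynomial
  normalise b (var i)   = ((i , b) ∷ []) ∷ []
  normalise b 0#        = []
  normalise b 1#        = [] ∷ []
  normalise b (e₁ + e₂) = normalise b e₁ ⊞ normalise b e₂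
  normalise b (e₁ * e₂) = normalise b e₁ ⊠ normalise b e₂
  normalise b (e ᶜ)     = normalise (not b) e

  combination : List Premise → Expr
  combination []                  = 0#
  combination (k · l ≈ r ∷ hs) = k * (l + r) + combination hs

  -- In characteristic 2 the equation l ≈ r says that l + r vanishes.
  residue : Consequence → Expr
  residue (l ≈ r by hs) = (l + r) + combination hs

  module Soundness {c ℓ : Level} (F : ConjugationRing c ℓ) where

    private module F = ConjugationRing F
    open F using (Carrier; refl; sym; trans; +-cong; +-congˡ; +-congʳ; *-cong; *-congˡ; *-congʳ)

    lookup : ∀ {n} → Vec Carrier n → ℕ → Carrier
    lookup []       _       = F.0#
    lookup (x ∷ ρ) zero    = x
    lookup (x ∷ ρ) (suc i) = lookup ρ i

    module _ (ρ : ℕ → Carrier) where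

      ⟦_⟧ : Expr → Carrier
      ⟦ var i ⟧   = ρ i
      ⟦ 0# ⟧      = F.0#
      ⟦ 1# ⟧      = F.1#
      ⟦ e₁ + e₂ ⟧ = ⟦ e₁ ⟧ F.+ ⟦ e₂ ⟧
      ⟦ e₁ * e₂ ⟧ = ⟦ e₁ ⟧ F.* ⟦ e₂ ⟧
      ⟦ e ᶜ ⟧     = ⟦ e ⟧ F.ᶜ

      Holds : Equation → Set ℓ
      Holds (l ≈ r) = ⟦ l ⟧ F.≈ ⟦ r ⟧

      Premises⇒_ : Consequence → Set ℓ
      Premises⇒ (e by [])             = Holds e
      Premises⇒ (e by ((_ · h) ∷ hs)) = Holds h → Premises⇒ (e by hs)

      private
        conjugateIf : Bool → Carrier → Carrier
        conjugateIf false x = x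
        conjugateIf true  x = x F.ᶜ

        ⟦_⟧ᵃ : Atom → Carrier
        ⟦ i , b ⟧ᵃ = conjugateIf b (ρ i)

        ⟦_⟧ᵐ : Monomial → Carrier
        ⟦ [] ⟧ᵐ     = F.1#
        ⟦ x ∷ m ⟧ᵐ = ⟦ x ⟧ᵃ F.* ⟦ m ⟧ᵐ

        ⟦_⟧ᵖ : Polynomial → Carrier
        ⟦ [] ⟧ᵖ     = F.0#
        ⟦ m ∷ p ⟧ᵖ = ⟦ m ⟧ᵐ F.+ ⟦ p ⟧ᵖ

        *-swap : ∀ x y z → x F.* (y F.* z) F.≈ y F.* (x F.* z)
        *-swap x y z = trans (sym (F.*-assoc x y z))
          (trans (*-congʳ (F.*-comm x y)) (F.*-assoc y x z))

        +-swap : ∀ x y z → x F.+ (y F.+ z) F.≈ y F.+ (x F.+ z)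
        +-swap x y z = trans (sym (F.+-assoc x y z))
          (trans (+-congʳ (F.+-comm x y)) (F.+-assoc y x z))

        insertAtom-sound : ∀ x m → ⟦ insertAtom x m ⟧ᵐ F.≈ ⟦ x ⟧ᵃ F.* ⟦ m ⟧ᵐ
        insertAtom-sound x []      = refl
        insertAtom-sound x (y ∷ m) with x <ᵃ y
        ... | true  = refl
        ... | false = trans (*-congˡ (insertAtom-sound x m)) (*-swap _ _ _)

        ·ᵐ-sound : ∀ m n → ⟦ m ·ᵐ n ⟧ᵐ F.≈ ⟦ m ⟧ᵐ F.* ⟦ n ⟧ᵐ
        ·ᵐ-sound []      n = sym (F.*-identityˡ _)
        ·ᵐ-sound (x ∷ m) n = trans (insertAtom-sound x (m ·ᵐ n))
          (trans (*-congˡ (·ᵐ-sound m n)) (sym (F.*-assoc _ _ _)))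

        insert-sound : ∀ m p → ⟦ insert m p ⟧ᵖ F.≈ ⟦ m ⟧ᵐ F.+ ⟦ p ⟧ᵖ
        insert-sound m []      = refl
        insert-sound m (n ∷ p) with m ≟ᵐ n
        ... | yes ≡.refl = sym (F.x+[x+y]≈y _ _)
        ... | no  _ with m <ᵐ n
        ...   | true  = refl
        ...   | false = trans (+-congˡ (insert-sound m p)) (+-swap _ _ _)

        ⊞-sound : ∀ p q → ⟦ p ⊞ q ⟧ᵖ F.≈ ⟦ p ⟧ᵖ F.+ ⟦ q ⟧ᵖ
        ⊞-sound []      q = sym (F.+-identityˡ _)
        ⊞-sound (m ∷ p) q = trans (insert-sound m (p ⊞ q))
          (trans (+-congˡ (⊞-sound p q)) (sym (F.+-assoc _ _ _)))

        scale-sound : ∀ m p → ⟦ scale m p ⟧ᵖ F.≈ ⟦ m ⟧ᵐ F.* ⟦ p ⟧ᵖ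
        scale-sound m []      = sym (F.zeroʳ _)
        scale-sound m (n ∷ p) = trans (insert-sound (m ·ᵐ n) (scale m p))
          (trans (+-cong (·ᵐ-sound m n) (scale-sound m p)) (sym (F.distribˡ _ _ _)))

        ⊠-sound : ∀ p q → ⟦ p ⊠ q ⟧ᵖ F.≈ ⟦ p ⟧ᵖ F.* ⟦ q ⟧ᵖ
        ⊠-sound []      q = sym (F.zeroˡ _)
        ⊠-sound (m ∷ p) q = trans (⊞-sound (scale m q) (p ⊠ q))
          (trans (+-cong (scale-sound m q) (⊠-sound p q)) (sym (F.distribʳ _ _ _)))

        conjugateIf-cong : ∀ b {x y} → x F.≈ y → conjugateIf b x F.≈ conjugateIf b y
        conjugateIf-cong false e = e
        conjugateIf-cong true  e = F.ᶜ-cong e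

        conjugateIf-not : ∀ b x → conjugateIf (not b) x F.≈ conjugateIf b (x F.ᶜ)
        conjugateIf-not false x = refl
        conjugateIf-not true  x = sym (F.ᶜ-involutive x)

        normalise-sound : ∀ b e → ⟦ normalise b e ⟧ᵖ F.≈ conjugateIf b ⟦ e ⟧
        normalise-sound b     (var i)   = trans (F.+-identityʳ _) (F.*-identityʳ _)
        normalise-sound false 0#        = refl
        normalise-sound true  0#        = sym F.0ᶜ≈0
        normalise-sound false 1#        = F.+-identityʳ _
        normalise-sound true  1#        = trans (F.+-identityʳ _) (sym F.1ᶜ≈1)
        normalise-sound b     (e₁ + e₂) = trans (⊞-sound (normalise b e₁) (normalise b e₂))
          (trans (+-cong (normalise-sound b e₁) (normalise-sound b e₂)) (homo b))
          where
          homo : ∀ b → conjugateIf b ⟦ e₁ ⟧ F.+ conjugateIf b ⟦ e₂ ⟧ F.≈ conjugateIf b ⟦ e₁ + e₂ ⟧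
          homo false = refl
          homo true  = sym (F.ᶜ-+ _ _)
        normalise-sound b     (e₁ * e₂) = trans (⊠-sound (normalise b e₁) (normalise b e₂))
          (trans (*-cong (normalise-sound b e₁) (normalise-sound b e₂)) (homo b))
          where
          homo : ∀ b → conjugateIf b ⟦ e₁ ⟧ F.* conjugateIf b ⟦ e₂ ⟧ F.≈ conjugateIf b ⟦ e₁ * e₂ ⟧
          homo false = refl
          homo true  = sym (F.ᶜ-* _ _)
        normalise-sound b     (e ᶜ)     =
          trans (normalise-sound (not b) e) (conjugateIf-not b ⟦ e ⟧)

        -- Each true premise makes its summand k (l + r) of the combination vanish; once all are
        -- used, the two sides of the conclusion add up to 0.
        discharge : ∀ l r hs → ⟦ l + r ⟧ F.≈ ⟦ combination hs ⟧ → Premises⇒ (l ≈ r by hs)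
        discharge l r []                 eq = F.x+y≈0⇒x≈y eq
        discharge l r (k · l′ ≈ r′ ∷ hs) eq h = discharge l r hs
          (trans eq (trans (+-congʳ (trans (*-congˡ (F.x≈y⇒x+y≈0 h)) (F.zeroʳ _))) (F.+-identityˡ _)))

      consequence-sound : ∀ s → normalise false (residue s) ≡ [] → Premises⇒ s
      consequence-sound (l ≈ r by hs) eq = discharge l r hs (F.x+y≈0⇒x≈y
        (trans (sym (normalise-sound false (residue (l ≈ r by hs)))) (F.reflexive (≡.cong ⟦_⟧ᵖ eq))))

    solve : ∀ n (s : Schema n) → normalise false (residue (instantiate n s 0)) ≡ [] →
            ∀ⁿʰ n (curryⁿ λ ρ → Premises⇒_ (lookup {n} ρ) (instantiate n s 0))
    solve n s eq = ⇐ n λ ρ → consequence-sound (lookup ρ) (instantiate n s 0) eq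
      where
      ⇐ : ∀ n {P : Vec Carrier n → Set ℓ} → (∀ ρ → P ρ) → ∀ⁿʰ n (curryⁿ P)
      ⇐ zero    p = p []
      ⇐ (suc n) p = ⇐ n (λ ρ → p (_ ∷ ρ))

-- Identities behind the comparison of determinants

module FieldIdentities {c ℓ : Level} (F : ConjugationRing c ℓ) where
  open Solver
  open Soundness F

  cancel-by = solve 3 (λ x y z → y ≈ 0# by y · x * z ≈ 1# ∷ z · x * y ≈ 0# ∷ []) ≡.refl
  square-sum = solve 2 (λ x y → (x + y) * (x + y) ≈ 0# by 1# · x * x ≈ y * y ∷ []) ≡.refl
  *-from-sum = solve 3 (λ x y z → x * (y + z) ≈ 0# by 1# · x * y ≈ x * z ∷ []) ≡.refl

module PencilIdentities {c ℓ : Level} (F : ConjugationRing c ℓ) where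
  open Solver
  open Soundness F

  -- Multiplicativity of the determinant: the four entries form the product of [ A C ; B D ] and
  -- [ e f ; gᶜ hᶜ ]. In the next three identities the matrix is a column times a row, so its
  -- determinant is 0; the polar identities are the corresponding mixed determinants.
  det-γ = solve 8 (λ A B C D e f g h →
    (A * e + C * g ᶜ) * (B * f + D * h ᶜ) + (B * e + D * g ᶜ) * (A * f + C * h ᶜ) ≈
    (A * D + B * C) * (e * h ᶜ + f * g ᶜ) by []) ≡.refl
  det-γ′ = solve 5 (λ C D g h w →
    w * C ᶜ * g * (w * D ᶜ * h) + w * C ᶜ * h * (w * D ᶜ * g) ≈ 0# by []) ≡.refl
  det-δ = solve 4 (λ C D e f → C * e * (D * f) + D * e * (C * f) ≈ 0# by []) ≡.refl
  det-δ′ = solve 4 (λ A B g h → A ᶜ * g * (B ᶜ * h) + A ᶜ * h * (B ᶜ * g) ≈ 0# by []) ≡.refl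
  polar-γγ = solve 9 (λ A B C D e f g h w →
    ((A * e + C * g ᶜ) * (w * D ᶜ * h) ᶜ + (B * f + D * h ᶜ) * (w * C ᶜ * g) ᶜ) +
    ((A * f + C * h ᶜ) * (w * D ᶜ * g) ᶜ + (B * e + D * g ᶜ) * (w * C ᶜ * h) ᶜ) ≈
    (A * D + B * C) * (e * h ᶜ + f * g ᶜ) * w ᶜ by []) ≡.refl
  polar-δδ = solve 8 (λ A B C D e f g h →
    (C * e * (B ᶜ * h) ᶜ + D * f * (A ᶜ * g) ᶜ) + (C * f * (B ᶜ * g) ᶜ + D * e * (A ᶜ * h) ᶜ) ≈
    (A * D + B * C) * (e * h ᶜ + f * g ᶜ) by []) ≡.refl
  polar-γδ = solve 8 (λ A B C D e f g h →
    ((A * e + C * g ᶜ) * (D * f) + (B * f + D * h ᶜ) * (C * e)) +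
    ((A * f + C * h ᶜ) * (D * e) + (B * e + D * g ᶜ) * (C * f)) ≈ 0# by []) ≡.refl
  polar-γδ′ = solve 7 (λ A B C D g h w →
    (w * C ᶜ * g * (B ᶜ * h) + w * D ᶜ * h * (A ᶜ * g)) +
    (w * C ᶜ * h * (B ᶜ * g) + w * D ᶜ * g * (A ᶜ * h)) ≈ 0# by []) ≡.refl
  polar-γδᶜ = solve 8 (λ A B C D e f g h →
    ((A * e + C * g ᶜ) * (B ᶜ * h) ᶜ + (B * f + D * h ᶜ) * (A ᶜ * g) ᶜ) +
    ((A * f + C * h ᶜ) * (B ᶜ * g) ᶜ + (B * e + D * g ᶜ) * (A ᶜ * h) ᶜ) ≈ 0# by []) ≡.refl
  polar-δγᶜ = solve 7 (λ C D e f g h w →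
    (C * e * (w * D ᶜ * h) ᶜ + D * f * (w * C ᶜ * g) ᶜ) +
    (C * f * (w * D ᶜ * g) ᶜ + D * e * (w * C ᶜ * h) ᶜ) ≈ 0# by []) ≡.refl

  -- After cancellation the hypotheses read uᶜ s + t = 0 and u s + t = 0 with s = γ₁δ₂ + γ₂δ₁ and t
  -- = γ₃δ₄ + γ₄δ₃; their sum isolates s. In `separate₃` the same happens with the Hermitian
  -- products γ₁δ₁ᶜ + γ₂δ₂ᶜ and γ₃δ₃ᶜ + γ₄δ₄ᶜ.
  separate₁ = solve 9 (λ u γ₁ γ₂ γ₃ γ₄ δ₁ δ₂ δ₃ δ₄ →
    (u + u ᶜ) * (γ₁ * δ₂ + γ₂ * δ₁) ≈ 0# by
      1# · (γ₁ * (δ₁ + u ᶜ * δ₂) + (γ₁ + u ᶜ * γ₂) * δ₁) + (γ₄ * δ₃ + γ₃ * δ₄) ≈ 0#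
    ∷ 1# · (γ₂ * (u * δ₁ + δ₂) + (u * γ₁ + γ₂) * δ₂) + (γ₃ * δ₄ + γ₄ * δ₃) ≈ 0# ∷ []) ≡.refl
  separate₂ = solve 9 (λ u γ₁ γ₂ γ₃ γ₄ δ₁ δ₂ δ₃ δ₄ →
    γ₃ * δ₄ + γ₄ * δ₃ ≈ 0# by
      1# · (γ₁ * (δ₁ + u ᶜ * δ₂) + (γ₁ + u ᶜ * γ₂) * δ₁) + (γ₄ * δ₃ + γ₃ * δ₄) ≈ 0#
    ∷ u ᶜ · γ₁ * δ₂ + γ₂ * δ₁ ≈ 0# ∷ []) ≡.refl
  separate₃ = solve 9 (λ u γ₁ γ₂ γ₃ γ₄ δ₁ δ₂ δ₃ δ₄ →
    (u + u ᶜ) * (γ₁ * δ₁ ᶜ + γ₂ * δ₂ ᶜ) ≈ 0# by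
      1# · (γ₁ * (u * δ₁ + δ₂) ᶜ + (γ₁ + u ᶜ * γ₂) * δ₂ ᶜ) + (γ₄ * δ₄ ᶜ + γ₃ * δ₃ ᶜ) ≈ 0#
    ∷ 1# · ((δ₁ * (u * γ₁ + γ₂) ᶜ + (δ₁ + u ᶜ * δ₂) * γ₂ ᶜ) + (δ₄ * γ₄ ᶜ + δ₃ * γ₃ ᶜ)) ᶜ ≈ 0# ᶜ ∷ []) ≡.refl
  separate₄ = solve 9 (λ u γ₁ γ₂ γ₃ γ₄ δ₁ δ₂ δ₃ δ₄ →
    γ₃ * δ₃ ᶜ + γ₄ * δ₄ ᶜ ≈ 0# by
      1# · (γ₁ * (u * δ₁ + δ₂) ᶜ + (γ₁ + u ᶜ * γ₂) * δ₂ ᶜ) + (γ₄ * δ₄ ᶜ + γ₃ * δ₃ ᶜ) ≈ 0#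
    ∷ u ᶜ · γ₁ * δ₁ ᶜ + γ₂ * δ₂ ᶜ ≈ 0# ∷ []) ≡.refl

  -- The hypotheses say that (p , q) and (r , s) are Hermitian orthogonal and proportional. A
  -- nonzero entry of one vector therefore makes the other isotropic for the sum of norms.
  isotropic₁ = solve 4 (λ p q r s → p * (r * r ᶜ + s * s ᶜ) ≈ 0# by
    r · p * r ᶜ + q * s ᶜ ≈ 0# ∷ s ᶜ · p * s + q * r ≈ 0# ∷ []) ≡.refl
  isotropic₂ = solve 4 (λ p q r s → q * (r * r ᶜ + s * s ᶜ) ≈ 0# by
    s · p * r ᶜ + q * s ᶜ ≈ 0# ∷ r ᶜ · p * s + q * r ≈ 0# ∷ []) ≡.refl
  isotropic₃ = solve 4 (λ p q r s → r * (p * p ᶜ + q * q ᶜ) ≈ 0# by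
    p · (p * r ᶜ + q * s ᶜ) ᶜ ≈ 0# ᶜ ∷ q ᶜ · p * s + q * r ≈ 0# ∷ []) ≡.refl
  isotropic₄ = solve 4 (λ p q r s → s * (p * p ᶜ + q * q ᶜ) ≈ 0# by
    q · (p * r ᶜ + q * s ᶜ) ᶜ ≈ 0# ᶜ ∷ p ᶜ · p * s + q * r ≈ 0# ∷ []) ≡.refl

  -- After cancellation the expressions equal to Λ wᶜ and Λ have the shape uᶜ n₁₂ + n₃₄ with sums of
  -- norms n₁₂ and n₃₄. If n₁₂ = 0 in both, Λ wᶜ and Λ are fixed by conjugation. In `w-fixed₂` n₃₄ =
  -- 0 instead, and both are uᶜ times a fixed element.
  w-fixed₁ = solve 11 (λ u w Λ γ₁ γ₂ γ₃ γ₄ δ₁ δ₂ δ₃ δ₄ →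
    Λ * (w + w ᶜ) ≈ 0# by
      1# · (γ₁ * (u * γ₁ + γ₂) ᶜ + (γ₁ + u ᶜ * γ₂) * γ₂ ᶜ) + (γ₄ * γ₄ ᶜ + γ₃ * γ₃ ᶜ) ≈ Λ * w ᶜ
    ∷ 1# · ((γ₁ * (u * γ₁ + γ₂) ᶜ + (γ₁ + u ᶜ * γ₂) * γ₂ ᶜ) + (γ₄ * γ₄ ᶜ + γ₃ * γ₃ ᶜ)) ᶜ ≈ (Λ * w ᶜ) ᶜ
    ∷ w · (δ₁ * (u * δ₁ + δ₂) ᶜ + (δ₁ + u ᶜ * δ₂) * δ₂ ᶜ) + (δ₄ * δ₄ ᶜ + δ₃ * δ₃ ᶜ) ≈ Λ
    ∷ w · ((δ₁ * (u * δ₁ + δ₂) ᶜ + (δ₁ + u ᶜ * δ₂) * δ₂ ᶜ) + (δ₄ * δ₄ ᶜ + δ₃ * δ₃ ᶜ)) ᶜ ≈ Λ ᶜ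
    ∷ u + u ᶜ · γ₁ * γ₁ ᶜ + γ₂ * γ₂ ᶜ ≈ 0#
    ∷ w * (u + u ᶜ) · δ₁ * δ₁ ᶜ + δ₂ * δ₂ ᶜ ≈ 0# ∷ []) ≡.refl
  w-fixed₂ = solve 11 (λ u w Λ γ₁ γ₂ γ₃ γ₄ δ₁ δ₂ δ₃ δ₄ →
    u * Λ * (w + w ᶜ) ≈ 0# by
      u · (γ₁ * (u * γ₁ + γ₂) ᶜ + (γ₁ + u ᶜ * γ₂) * γ₂ ᶜ) + (γ₄ * γ₄ ᶜ + γ₃ * γ₃ ᶜ) ≈ Λ * w ᶜ
    ∷ u ᶜ · ((γ₁ * (u * γ₁ + γ₂) ᶜ + (γ₁ + u ᶜ * γ₂) * γ₂ ᶜ) + (γ₄ * γ₄ ᶜ + γ₃ * γ₃ ᶜ)) ᶜ ≈ (Λ * w ᶜ) ᶜ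
    ∷ u * w · (δ₁ * (u * δ₁ + δ₂) ᶜ + (δ₁ + u ᶜ * δ₂) * δ₂ ᶜ) + (δ₄ * δ₄ ᶜ + δ₃ * δ₃ ᶜ) ≈ Λ
    ∷ u ᶜ * w · ((δ₁ * (u * δ₁ + δ₂) ᶜ + (δ₁ + u ᶜ * δ₂) * δ₂ ᶜ) + (δ₄ * δ₄ ᶜ + δ₃ * δ₃ ᶜ)) ᶜ ≈ Λ ᶜ
    ∷ u + u ᶜ · γ₃ * γ₃ ᶜ + γ₄ * γ₄ ᶜ ≈ 0#
    ∷ (u + u ᶜ) * w · δ₃ * δ₃ ᶜ + δ₄ * δ₄ ᶜ ≈ 0# ∷ []) ≡.refl

  Λ-vanishes₁ = solve 6 (λ u Λ γ₁ γ₂ γ₃ γ₄ → Λ ≈ 0# by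
    1# · γ₁ * (γ₁ + u ᶜ * γ₂) + γ₃ * γ₄ ≈ Λ ∷ γ₁ + u ᶜ * γ₂ · γ₁ ≈ 0# ∷ γ₄ · γ₃ ≈ 0# ∷ []) ≡.refl
  Λ-vanishes₂ = solve 6 (λ u Λ δ₁ δ₂ δ₃ δ₄ → Λ ≈ 0# by
      1# · (δ₁ * (u * δ₁ + δ₂) ᶜ + (δ₁ + u ᶜ * δ₂) * δ₂ ᶜ) + (δ₄ * δ₄ ᶜ + δ₃ * δ₃ ᶜ) ≈ Λ
    ∷ u ᶜ * δ₁ ᶜ · δ₁ ≈ 0# ∷ u ᶜ * δ₂ ᶜ · δ₂ ≈ 0# ∷ δ₃ ᶜ · δ₃ ≈ 0# ∷ δ₄ ᶜ · δ₄ ≈ 0# ∷ []) ≡.refl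

  drop-summand = solve 3 (λ x y z → x ≈ 0# by 1# · x + y * z ≈ 0# ∷ z · y ≈ 0# ∷ []) ≡.refl
  kernel₁ = solve 3 (λ x y u → y * y ≈ 0# by 1# · y * (u * x + y) ≈ 0# ∷ u * y · x ≈ 0# ∷ []) ≡.refl
  kernel₂ = solve 3 (λ x y u → x * x ≈ 0# by 1# · x * (x + u ᶜ * y) ≈ 0# ∷ u ᶜ * x · y ≈ 0# ∷ []) ≡.refl
  kernel₃ = solve 3 (λ x y u → x * (u * u ᶜ + 1#) ≈ 0# by
    1# · x + u ᶜ * y ≈ 0# ∷ u ᶜ · u * x + y ≈ 0# ∷ []) ≡.refl

  Λ-real = solve 6 (λ u Λ δ₁ δ₂ δ₃ δ₄ → Λ ᶜ ≈ Λ by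
      1# · (δ₁ * (u * δ₁ + δ₂) ᶜ + (δ₁ + u ᶜ * δ₂) * δ₂ ᶜ) + (δ₄ * δ₄ ᶜ + δ₃ * δ₃ ᶜ) ≈ Λ
    ∷ 1# · ((δ₁ * (u * δ₁ + δ₂) ᶜ + (δ₁ + u ᶜ * δ₂) * δ₂ ᶜ) + (δ₄ * δ₄ ᶜ + δ₃ * δ₃ ᶜ)) ᶜ ≈ Λ ᶜ
    ∷ (u + u ᶜ) * δ₁ ᶜ · δ₁ ≈ 0# ∷ (u + u ᶜ) * δ₂ ᶜ · δ₂ ≈ 0# ∷ []) ≡.refl

  γ-square₁ = solve 6 (λ u Λ γ₁ γ₂ γ₃ γ₄ → γ₁ * γ₁ ≈ Λ by
    1# · γ₁ * (γ₁ + u ᶜ * γ₂) + γ₃ * γ₄ ≈ Λ ∷ γ₁ * u ᶜ · γ₂ ≈ 0# ∷ γ₄ · γ₃ ≈ 0# ∷ []) ≡.refl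
  γ-square₂ = solve 6 (λ u Λ γ₁ γ₂ γ₃ γ₄ → (u * u ᶜ + 1#) * (γ₁ * γ₁) ≈ Λ by
    1# · γ₁ * (γ₁ + u ᶜ * γ₂) + γ₃ * γ₄ ≈ Λ ∷ γ₁ * u ᶜ · u * γ₁ + γ₂ ≈ 0# ∷ γ₄ · γ₃ ≈ 0# ∷ []) ≡.refl
  real-square₁ = solve 2 (λ x y → x ᶜ * x ᶜ ≈ x * x by
    1# · x * x ≈ y ∷ 1# · (x * x) ᶜ ≈ y ᶜ ∷ 1# · y ᶜ ≈ y ∷ []) ≡.refl
  real-square₂ = solve 3 (λ u x y → (u * u ᶜ + 1#) * (x ᶜ * x ᶜ) ≈ (u * u ᶜ + 1#) * (x * x) by
    1# · (u * u ᶜ + 1#) * (x * x) ≈ y ∷ 1# · ((u * u ᶜ + 1#) * (x * x)) ᶜ ≈ y ᶜ ∷ 1# · y ᶜ ≈ y ∷ []) ≡.refl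

  same-parameter₁ = solve 7 (λ u w Λ γ₁ γ₂ γ₃ γ₄ → Λ * u ᶜ ≈ Λ * w ᶜ by
      1# · (γ₁ * (u * γ₁ + γ₂) ᶜ + (γ₁ + u ᶜ * γ₂) * γ₂ ᶜ) + (γ₄ * γ₄ ᶜ + γ₃ * γ₃ ᶜ) ≈ Λ * w ᶜ
    ∷ u ᶜ · γ₁ * γ₁ ≈ Λ ∷ u ᶜ * γ₁ · γ₁ ᶜ ≈ γ₁
    ∷ u ᶜ * γ₂ ᶜ · γ₂ ≈ 0# ∷ γ₄ ᶜ · γ₄ ≈ 0# ∷ γ₃ ᶜ · γ₃ ≈ 0# ∷ []) ≡.refl
  same-parameter₂ = solve 7 (λ u w Λ γ₁ γ₂ γ₃ γ₄ → Λ * u ᶜ ≈ Λ * w ᶜ by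
      1# · (γ₁ * (u * γ₁ + γ₂) ᶜ + (γ₁ + u ᶜ * γ₂) * γ₂ ᶜ) + (γ₄ * γ₄ ᶜ + γ₃ * γ₃ ᶜ) ≈ Λ * w ᶜ
    ∷ u ᶜ · (u * u ᶜ + 1#) * (γ₁ * γ₁) ≈ Λ ∷ u ᶜ * γ₁ * (u * u ᶜ + 1#) · γ₁ ᶜ ≈ γ₁
    ∷ u ᶜ * γ₂ ᶜ · u * γ₁ + γ₂ ≈ 0# ∷ u ᶜ * u * γ₁ · (u * γ₁ + γ₂) ᶜ ≈ 0# ᶜ
    ∷ γ₄ ᶜ · γ₄ ≈ 0# ∷ γ₃ ᶜ · γ₃ ≈ 0# ∷ []) ≡.refl
  kill-sum = solve 4 (λ p q r s → p ≈ 0# by 1# · p ≈ q + s * r ∷ 1# · q ≈ 0# ∷ s · r ≈ 0# ∷ []) ≡.refl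
  kill-sum′ = solve 4 (λ p q r s → p ≈ 0# by 1# · p ≈ s * q + r ∷ s · q ≈ 0# ∷ 1# · r ≈ 0# ∷ []) ≡.refl
  diagonal-entry = solve 10 (λ A B C D e f g h u w → D * h ᶜ ≈ A * e by
      1# · B * f + D * h ᶜ ≈ (A * e + C * g ᶜ) + u ᶜ * (w * C ᶜ * g)
    ∷ f · B ≈ 0# ∷ g ᶜ · C ≈ 0# ∷ u ᶜ * w * C ᶜ · g ≈ 0# ∷ []) ≡.refl
  antidiagonal-entry = solve 10 (λ A B C D e f g h u w → B * f ≈ (1# + w * w ᶜ) * (C * g ᶜ) by
      1# · B * f + D * h ᶜ ≈ (A * e + C * g ᶜ) + u ᶜ * (w * C ᶜ * g)
    ∷ h ᶜ · D ≈ 0# ∷ e · A ≈ 0# ∷ w * C ᶜ * g · u ᶜ ≈ w ᶜ ∷ w * w ᶜ · (C * g ᶜ) ᶜ ≈ C * g ᶜ ∷ []) ≡.refl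
  left-summand = solve 4 (λ p q r s → p * q ≈ p * q + r * s by s · r ≈ 0# ∷ []) ≡.refl
  right-summand = solve 4 (λ p q r s → r * s ≈ p * q + r * s by q · p ≈ 0# ∷ []) ≡.refl

-- Fields with an involution and the shape of the matrices

record ConjugationField (c ℓ : Level) : Set (Level.suc (c ⊔ ℓ)) where
  field
    conjugationRing : ConjugationRing c ℓ

  open ConjugationRing conjugationRing public
  open Automorphisms commutativeRing public

  infix 4 _≟_
  field
    _≟_     : Decidable _≈_
    inverse : ∀ {x} → ¬ x ≈ 0# → ∃ λ y → x * y ≈ 1#
    1≉0     : ¬ 1# ≈ 0#
    sqrt    : ∀ {x} → x ᶜ ≈ x → ∃ λ y → y * y ≈ x
    -- In the finite field this holds because conjugation is the power map with exponent q.
    ⟦⟧-ᶜ    : ∀ φ x → Automorphism.⟦ φ ⟧ (x ᶜ) ≈ Automorphism.⟦ φ ⟧ x ᶜ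
    injective⇒surjective : ∀ {f} → Congruent _≈_ _≈_ f → Injective _≈_ _≈_ f → Surjective _≈_ _≈_ f

module FieldProperties {c ℓ : Level} (K : ConjugationField c ℓ) where

  open ConjugationField K
  private F = conjugationRing

  infix 4 _≉0
  _≉0 : Carrier → Set ℓ
  x ≉0 = ¬ x ≈ 0#

  open FieldIdentities F

  *-cancelˡ-0 : ∀ {x y} → x ≉0 → x * y ≈ 0# → y ≈ 0#
  *-cancelˡ-0 x≉0 xy≈0 = cancel-by (proj₂ (inverse x≉0)) xy≈0

  *-cancelˡ : ∀ {x y z} → x ≉0 → x * y ≈ x * z → y ≈ z
  *-cancelˡ x≉0 e = x+y≈0⇒x≈y (*-cancelˡ-0 x≉0 (*-from-sum e))

  *-≉0 : ∀ {x y} → x ≉0 → y ≉0 → x * y ≉0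
  *-≉0 x≉0 y≉0 xy≈0 = y≉0 (*-cancelˡ-0 x≉0 xy≈0)

  *-≈0 : ∀ {x y} → x * y ≈ 0# → x ≈ 0# ⊎ y ≈ 0#
  *-≈0 {x} xy≈0 with x ≟ 0#
  ... | yes x≈0 = inj₁ x≈0
  ... | no  x≉0 = inj₂ (*-cancelˡ-0 x≉0 xy≈0)

  square-zero : ∀ {x} → x * x ≈ 0# → x ≈ 0#
  square-zero e = [ id , id ]′ (*-≈0 e)

  ≉0-*ˡ : ∀ {x y} → x * y ≉0 → x ≉0
  ≉0-*ˡ xy≉0 x≈0 = xy≉0 (trans (*-congʳ x≈0) (zeroˡ _))

  ≉0-*ʳ : ∀ {x y} → x * y ≉0 → y ≉0
  ≉0-*ʳ xy≉0 y≈0 = xy≉0 (trans (*-congˡ y≈0) (zeroʳ _))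

  ≉0-resp : ∀ {x y} → x ≈ y → x ≉0 → y ≉0
  ≉0-resp x≈y x≉0 y≈0 = x≉0 (trans x≈y y≈0)

  ᶜ-injective : ∀ {x y} → x ᶜ ≈ y ᶜ → x ≈ y
  ᶜ-injective {x} {y} e = trans (sym (ᶜ-involutive x)) (trans (ᶜ-cong e) (ᶜ-involutive y))

  ᶜ-≈0 : ∀ {x} → x ᶜ ≈ 0# → x ≈ 0#
  ᶜ-≈0 {x} xᶜ≈0 = trans (sym (ᶜ-involutive x)) (trans (ᶜ-cong xᶜ≈0) 0ᶜ≈0)

  ≉0-ᶜ : ∀ {x} → x ≉0 → x ᶜ ≉0
  ≉0-ᶜ x≉0 = x≉0 ∘ ᶜ-≈0

  ᶜ-≉0 : ∀ {x} → x ᶜ ≉0 → x ≉0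
  ᶜ-≉0 xᶜ≉0 x≈0 = xᶜ≉0 (trans (ᶜ-cong x≈0) 0ᶜ≈0)

  -- In characteristic 2, x² + y² = (x + y)². This uniqueness of square roots is what later
  -- identifies dependent matrix entries by their squares.
  square-injective : ∀ {x y} → x * x ≈ y * y → x ≈ y
  square-injective {x} {y} e with *-≈0 (square-sum {x} {y} e)
  ... | inj₁ p = x+y≈0⇒x≈y p
  ... | inj₂ p = x+y≈0⇒x≈y p

  -- For the product (X , Y) of (a , b) and (c , d) in B(w), the coefficients of the form
  -- x X + xᶜ Xᶜ + y Y + yᶜ Yᶜ in (a , b) , (c , dᶜ) and in (aᶜ , bᶜ) , (cᶜ , d) are the matrices
  --   [ x  yᶜ ; y  x + wᶜ xᶜ ]   and   [ xᶜ  y ; yᶜ  xᶜ + w x ].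
  -- An isotopy multiplies both by matrices on either side, hence scales their determinants;
  -- γᵢ and δᵢ are the entries of the map it induces on X , Xᶜ , Y , Yᶜ, and E₁ – E₁₀ compare
  -- the coefficients of the determinants and of their polar forms.
  module Pencil
    {A B C D e f g h u w : Carrier}
    (r₁ : B * e + D * g ᶜ ≈ w * C ᶜ * h)
    (r₂ : A * f + C * h ᶜ ≈ w * D ᶜ * g)
    (r₃ : B * f + D * h ᶜ ≈ (A * e + C * g ᶜ) + u ᶜ * (w * C ᶜ * g))
    (r₄ : w * D ᶜ * h ≈ u * (A * e + C * g ᶜ) + w * C ᶜ * g)
    (d₁ : D * e ≈ A ᶜ * h)
    (d₂ : C * f ≈ B ᶜ * g)
    (d₃ : D * f ≈ C * e + u ᶜ * (A ᶜ * g))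
    (d₄ : B ᶜ * h ≈ u * (C * e) + A ᶜ * g)
    (AD+BC≉0 : A * D + B * C ≉0)
    (ehᶜ+fgᶜ≉0 : e * h ᶜ + f * g ᶜ ≉0)
    (wᶜ≉w : ¬ w ᶜ ≈ w) (uᶜ≉u : ¬ u ᶜ ≈ u) (uuᶜ≉1 : ¬ u * u ᶜ ≈ 1#)
    where

    private
      γ₁ γ₂ γ₃ γ₄ δ₁ δ₂ δ₃ δ₄ Λ : Carrier
      γ₁ = A * e + C * g ᶜ
      γ₂ = w * C ᶜ * g
      γ₃ = w * C ᶜ * h
      γ₄ = w * D ᶜ * g
      δ₁ = C * e
      δ₂ = A ᶜ * g
      δ₃ = D * e
      δ₄ = C * f
      Λ  = (A * D + B * C) * (e * h ᶜ + f * g ᶜ)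

      Λ≉0 : Λ ≉0
      Λ≉0 = *-≉0 AD+BC≉0 ehᶜ+fgᶜ≉0

      -- Polarisation of the 2×2 determinant, the entries of each matrix being listed by rows.
      polar : (x₁ x₂ x₃ x₄ y₁ y₂ y₃ y₄ : Carrier) → Carrier
      polar x₁ x₂ x₃ x₄ y₁ y₂ y₃ y₄ = (x₁ * y₄ + x₄ * y₁) + (x₂ * y₃ + x₃ * y₂)

      polar-cong : ∀ {x₁ x₂ x₃ x₄ y₁ y₂ y₃ y₄ x₁′ x₂′ x₃′ x₄′ y₁′ y₂′ y₃′ y₄′} →
        x₁ ≈ x₁′ → x₂ ≈ x₂′ → x₃ ≈ x₃′ → x₄ ≈ x₄′ → y₁ ≈ y₁′ → y₂ ≈ y₂′ → y₃ ≈ y₃′ → y₄ ≈ y₄′ →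
        polar x₁ x₂ x₃ x₄ y₁ y₂ y₃ y₄ ≈ polar x₁′ x₂′ x₃′ x₄′ y₁′ y₂′ y₃′ y₄′
      polar-cong a b c d a′ b′ c′ d′ =
        +-cong (+-cong (*-cong a d′) (*-cong d a′)) (+-cong (*-cong b c′) (*-cong c b′))

      open PencilIdentities F

      -- γ is the image of X and δ that of Y; conjugating and exchanging the entries within each
      -- pair gives the images of Xᶜ and Yᶜ. The hypotheses `r₁` to `d₄` say that these images
      -- belong to the space of matrices of B(u). The squares give `E₁`, `E₂`, `E₄`, `E₅`, the six
      -- mixed terms the rest; `E₂`, `E₅` and `E₁₀` are written conjugated.
      E₁ : γ₁ * (γ₁ + u ᶜ * γ₂) + γ₃ * γ₄ ≈ Λ
      E₁ = trans (+-cong (*-congˡ (sym r₃)) (*-cong (sym r₁) (sym r₂))) det-γ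

      E₂ : γ₂ * (u * γ₁ + γ₂) + γ₃ * γ₄ ≈ 0#
      E₂ = trans (+-congʳ (*-congˡ (sym r₄))) det-γ′

      E₃ : polar γ₁ γ₄ γ₃ (γ₁ + u ᶜ * γ₂) (γ₂ ᶜ) (γ₃ ᶜ) (γ₄ ᶜ) ((u * γ₁ + γ₂) ᶜ) ≈ Λ * w ᶜ
      E₃ = trans (polar-cong refl (sym r₂) (sym r₁) (sym r₃) refl refl refl (ᶜ-cong (sym r₄))) polar-γγ

      E₄ : δ₁ * (δ₁ + u ᶜ * δ₂) + δ₃ * δ₄ ≈ 0#
      E₄ = trans (+-congʳ (*-congˡ (sym d₃))) det-δ

      E₅ : δ₂ * (u * δ₁ + δ₂) + δ₃ * δ₄ ≈ 0#
      E₅ = trans (+-cong (*-congˡ (sym d₄)) (*-cong d₁ d₂)) det-δ′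

      E₆ : polar δ₁ δ₄ δ₃ (δ₁ + u ᶜ * δ₂) (δ₂ ᶜ) (δ₃ ᶜ) (δ₄ ᶜ) ((u * δ₁ + δ₂) ᶜ) ≈ Λ
      E₆ = trans (polar-cong refl refl refl (sym d₃) refl (ᶜ-cong d₁) (ᶜ-cong d₂) (ᶜ-cong (sym d₄))) polar-δδ

      E₇ : polar γ₁ γ₄ γ₃ (γ₁ + u ᶜ * γ₂) δ₁ δ₄ δ₃ (δ₁ + u ᶜ * δ₂) ≈ 0#
      E₇ = trans (polar-cong refl (sym r₂) (sym r₁) (sym r₃) refl refl refl (sym d₃)) polar-γδ

      E₈ : polar γ₁ γ₄ γ₃ (γ₁ + u ᶜ * γ₂) (δ₂ ᶜ) (δ₃ ᶜ) (δ₄ ᶜ) ((u * δ₁ + δ₂) ᶜ) ≈ 0#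
      E₈ = trans (polar-cong refl (sym r₂) (sym r₁) (sym r₃) refl (ᶜ-cong d₁) (ᶜ-cong d₂) (ᶜ-cong (sym d₄))) polar-γδᶜ

      E₉ : polar δ₁ δ₄ δ₃ (δ₁ + u ᶜ * δ₂) (γ₂ ᶜ) (γ₃ ᶜ) (γ₄ ᶜ) ((u * γ₁ + γ₂) ᶜ) ≈ 0#
      E₉ = trans (polar-cong refl refl refl (sym d₃) refl refl refl (ᶜ-cong (sym r₄))) polar-δγᶜ

      E₁₀ : polar γ₂ γ₃ γ₄ (u * γ₁ + γ₂) δ₂ δ₃ δ₄ (u * δ₁ + δ₂) ≈ 0#
      E₁₀ = trans (polar-cong refl refl refl (sym r₄) refl d₁ d₂ (sym d₄)) polar-γδ′

      u+uᶜ≉0 : u + u ᶜ ≉0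
      u+uᶜ≉0 p = uᶜ≉u (sym (x+y≈0⇒x≈y p))

      w+wᶜ≉0 : w + w ᶜ ≉0
      w+wᶜ≉0 p = wᶜ≉w (sym (x+y≈0⇒x≈y p))

      u≉0 : u ≉0
      u≉0 p = uᶜ≉u (trans (trans (ᶜ-cong p) 0ᶜ≈0) (sym p))

      uuᶜ+1≉0 : u * u ᶜ + 1# ≉0
      uuᶜ+1≉0 p = uuᶜ≉1 (x+y≈0⇒x≈y p)

      orthogonal₁₂ : γ₁ * δ₂ + γ₂ * δ₁ ≈ 0#
      orthogonal₁₂ = *-cancelˡ-0 u+uᶜ≉0 (separate₁ {_} {γ₁} {γ₂} {γ₃} {γ₄} {δ₁} {δ₂} {δ₃} {δ₄} E₇ E₁₀)

      orthogonal₃₄ : γ₃ * δ₄ + γ₄ * δ₃ ≈ 0#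
      orthogonal₃₄ = separate₂ {u} {γ₁} {γ₂} {γ₃} {γ₄} {δ₁} {δ₂} {δ₃} {δ₄} E₇ orthogonal₁₂

      unitary₁₂ : γ₁ * δ₁ ᶜ + γ₂ * δ₂ ᶜ ≈ 0#
      unitary₁₂ = *-cancelˡ-0 u+uᶜ≉0
        (separate₃ {_} {γ₁} {γ₂} {γ₃} {γ₄} {δ₁} {δ₂} {δ₃} {δ₄} E₈ (ᶜ-cong E₉))

      unitary₃₄ : γ₃ * δ₃ ᶜ + γ₄ * δ₄ ᶜ ≈ 0#
      unitary₃₄ = separate₄ {u} {γ₁} {γ₂} {γ₃} {γ₄} {δ₁} {δ₂} {δ₃} {δ₄} E₈ unitary₁₂

      Zero : Carrier → Carrier → Set ℓ
      Zero x y = x ≈ 0# × y ≈ 0#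

      zero? : ∀ x y → Zero x y ⊎ (x ≉0 ⊎ y ≉0)
      zero? x y with x ≟ 0# | y ≟ 0#
      ... | yes p | yes q = inj₁ (p , q)
      ... | no  p | _     = inj₂ (inj₁ p)
      ... | yes _ | no  q = inj₂ (inj₂ q)

      zero-or-isotropic : ∀ {p q r s} → p * s + q * r ≈ 0# → p * r ᶜ + q * s ᶜ ≈ 0# →
        Zero p q ⊎ Zero r s ⊎ (p * p ᶜ + q * q ᶜ ≈ 0# × r * r ᶜ + s * s ᶜ ≈ 0#)
      zero-or-isotropic {p} {q} {r} {s} o v with zero? p q | zero? r s
      ... | inj₁ z | _      = inj₁ z
      ... | inj₂ _ | inj₁ z = inj₂ (inj₁ z)
      ... | inj₂ m | inj₂ n = inj₂ (inj₂
        ( [ (λ r≉0 → *-cancelˡ-0 r≉0 (isotropic₃ {p} {q} {r} {s} (ᶜ-cong v) o))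
          , (λ s≉0 → *-cancelˡ-0 s≉0 (isotropic₄ {p} {q} {r} {s} (ᶜ-cong v) o)) ]′ n
        , [ (λ p≉0 → *-cancelˡ-0 p≉0 (isotropic₁ {p} {q} {r} {s} v o))
          , (λ q≉0 → *-cancelˡ-0 q≉0 (isotropic₂ {p} {q} {r} {s} v o)) ]′ m ))

      zero₁₂ : Zero γ₁ γ₂ ⊎ Zero δ₁ δ₂
      zero₁₂ = [ inj₁ , [ inj₂ , (λ (m , n) → contradiction
        (*-cancelˡ-0 Λ≉0 (w-fixed₁ {u} {w} {Λ} {γ₁} {γ₂} {γ₃} {γ₄} {δ₁} {δ₂} {δ₃} {δ₄}
          E₃ (ᶜ-cong E₃) E₆ (ᶜ-cong E₆) m n)) w+wᶜ≉0) ]′ ]′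
        (zero-or-isotropic orthogonal₁₂ unitary₁₂)

      zero₃₄ : Zero γ₃ γ₄ ⊎ Zero δ₃ δ₄
      zero₃₄ = [ inj₁ , [ inj₂ , (λ (m , n) → contradiction
        (*-cancelˡ-0 (*-≉0 u≉0 Λ≉0) (w-fixed₂ {u} {w} {Λ} {γ₁} {γ₂} {γ₃} {γ₄} {δ₁} {δ₂} {δ₃} {δ₄}
          E₃ (ᶜ-cong E₃) E₆ (ᶜ-cong E₆) m n)) w+wᶜ≉0) ]′ ]′
        (zero-or-isotropic orthogonal₃₄ unitary₃₄)

      -- If neither x nor y is known to vanish, both linear factors do, and their determinant 1 +
      -- N(u) is nonzero because N(u) ≠ 1.
      kernel : ∀ {x y} → x * (x + u ᶜ * y) ≈ 0# → y * (u * x + y) ≈ 0# → Zero x y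
      kernel {x} {y} p q with *-≈0 p | *-≈0 q
      ... | inj₁ x≈0 | _        = x≈0 , square-zero (kernel₁ {x} {y} {u} q x≈0)
      ... | inj₂ _   | inj₁ y≈0 = square-zero (kernel₂ {x} {y} {u} p y≈0) , y≈0
      ... | inj₂ m   | inj₂ n   = x≈0 , trans (sym (+-identityˡ y))
        (trans (+-congʳ (sym (trans (*-congˡ x≈0) (zeroʳ u)))) n)
        where
        x≈0 : x ≈ 0#
        x≈0 = *-cancelˡ-0 uuᶜ+1≉0 (trans (*-comm _ _) (kernel₃ {x} {y} {u} m n))

      δ≉0 : Zero δ₁ δ₂ → ¬ Zero δ₃ δ₄
      δ≉0 (p , q) (p′ , q′) = Λ≉0 (Λ-vanishes₂ {u} {Λ} {δ₁} {δ₂} {δ₃} {δ₄} E₆ p q p′ q′)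

      γ≉0 : Zero γ₁ γ₂ → ¬ Zero γ₃ γ₄
      γ≉0 (p , _) (q , _) = Λ≉0 (Λ-vanishes₁ {u} {Λ} {γ₁} {γ₂} {γ₃} {γ₄} E₁ p q)

      -- With δ₃ = δ₄ = 0, `E₄` and `E₅` become the hypotheses of `kernel`; then all of δ vanishes
      -- and `E₆` gives Λ = 0.
      δ₃₄≉0 : ¬ Zero δ₃ δ₄
      δ₃₄≉0 z@(p , _) = δ≉0 (kernel (drop-summand E₄ p) (drop-summand E₅ p)) z

      δ₁₂-zero : Zero δ₁ δ₂
      δ₁₂-zero = [ (λ γ₁₂≈0 → [ ⊥-elim ∘ γ≉0 γ₁₂≈0 , ⊥-elim ∘ δ₃₄≉0 ]′ zero₃₄) , id ]′ zero₁₂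

      γ₃₄-zero : Zero γ₃ γ₄
      γ₃₄-zero = [ id , ⊥-elim ∘ δ₃₄≉0 ]′ zero₃₄

      δ₁≈0 : δ₁ ≈ 0#
      δ₁≈0 = proj₁ δ₁₂-zero

      δ₂≈0 : δ₂ ≈ 0#
      δ₂≈0 = proj₂ δ₁₂-zero

      γ₃≈0 : γ₃ ≈ 0#
      γ₃≈0 = proj₁ γ₃₄-zero

      γ₄≈0 : γ₄ ≈ 0#
      γ₄≈0 = proj₂ γ₃₄-zero

      Λᶜ≈Λ : Λ ᶜ ≈ Λ
      Λᶜ≈Λ = Λ-real {u} {Λ} {δ₁} {δ₂} {δ₃} {δ₄} E₆ (ᶜ-cong E₆) δ₁≈0 δ₂≈0

      -- As γ₃ = 0, `E₂` leaves γ₂ = 0 or γ₂ = u γ₁. Accordingly Λ is γ₁² times 1 or 1 + N(u), a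
      -- real factor, so γ₁ is real by uniqueness of roots, and `E₃` becomes Λ uᶜ = Λ wᶜ.
      γ₁-real×u≈w : γ₁ ᶜ ≈ γ₁ × u ≈ w
      γ₁-real×u≈w = [ untwisted , twisted ]′
        (*-≈0 (trans (sym (trans (+-congˡ (trans (*-congʳ γ₃≈0) (zeroˡ _))) (+-identityʳ _))) E₂))
        where
        untwisted : γ₂ ≈ 0# → γ₁ ᶜ ≈ γ₁ × u ≈ w
        untwisted γ₂≈0 = real , ᶜ-injective (*-cancelˡ Λ≉0
          (same-parameter₁ {u} {w} {Λ} {γ₁} {γ₂} {γ₃} {γ₄} E₃ sq real γ₂≈0 γ₄≈0 γ₃≈0))
          where
          sq : γ₁ * γ₁ ≈ Λ
          sq = γ-square₁ {u} {Λ} {γ₁} {γ₂} {γ₃} {γ₄} E₁ γ₂≈0 γ₃≈0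
          real : γ₁ ᶜ ≈ γ₁
          real = square-injective (real-square₁ {γ₁} {Λ} sq (ᶜ-cong sq) Λᶜ≈Λ)
        twisted : u * γ₁ + γ₂ ≈ 0# → γ₁ ᶜ ≈ γ₁ × u ≈ w
        twisted uγ₁+γ₂≈0 = real , ᶜ-injective (*-cancelˡ Λ≉0
          (same-parameter₂ {u} {w} {Λ} {γ₁} {γ₂} {γ₃} {γ₄} E₃ sq real uγ₁+γ₂≈0 (ᶜ-cong uγ₁+γ₂≈0) γ₄≈0 γ₃≈0))
          where
          sq : (u * u ᶜ + 1#) * (γ₁ * γ₁) ≈ Λ
          sq = γ-square₂ {u} {Λ} {γ₁} {γ₂} {γ₃} {γ₄} E₁ uγ₁+γ₂≈0 γ₃≈0
          real : γ₁ ᶜ ≈ γ₁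
          real = square-injective (*-cancelˡ uuᶜ+1≉0 (real-square₂ {u} {γ₁} {Λ} sq (ᶜ-cong sq) Λᶜ≈Λ))

    u≈w : u ≈ w
    u≈w = proj₂ γ₁-real×u≈w

    data Shape : Set ℓ where
      diagonal : B ≈ 0# → C ≈ 0# → f ≈ 0# → g ≈ 0# → A ≉0 → h ≉0 →
        (A * e) ᶜ ≈ A * e → D * h ᶜ ≈ A * e → Shape
      antidiagonal : A ≈ 0# → D ≈ 0# → e ≈ 0# → h ≈ 0# → B ≉0 → g ≉0 →
        (C * g ᶜ) ᶜ ≈ C * g ᶜ → B * f ≈ (1# + w * w ᶜ) * (C * g ᶜ) → Shape

    private
      diagonal-shape : C * f ≈ 0# → D * e ≉0 → Shape
      diagonal-shape Cf≈0 De≉0 = diagonal B≈0 C≈0 f≈0 g≈0 A≉0 h≉0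
        (trans (ᶜ-cong Ae≈γ₁) (trans (proj₁ γ₁-real×u≈w) (sym Ae≈γ₁)))
        (diagonal-entry {A} {B} {C} {D} {e} {f} {g} {h} {u} {w} r₃ B≈0 C≈0 g≈0)
        where
        A≉0 : A ≉0
        A≉0 = ᶜ-≉0 (≉0-*ˡ (≉0-resp d₁ De≉0))
        h≉0 : h ≉0
        h≉0 = ≉0-*ʳ (≉0-resp d₁ De≉0)
        C≈0 : C ≈ 0#
        C≈0 = *-cancelˡ-0 (≉0-*ʳ De≉0) (trans (*-comm e C) δ₁≈0)
        f≈0 : f ≈ 0#
        f≈0 = *-cancelˡ-0 (≉0-*ˡ De≉0) (kill-sum d₃ δ₁≈0 δ₂≈0)
        g≈0 : g ≈ 0#
        g≈0 = *-cancelˡ-0 (≉0-ᶜ A≉0) δ₂≈0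
        B≈0 : B ≈ 0#
        B≈0 = ᶜ-≈0 (*-cancelˡ-0 h≉0 (trans (*-comm h (B ᶜ)) (kill-sum′ d₄ δ₁≈0 δ₂≈0)))
        Ae≈γ₁ : A * e ≈ γ₁
        Ae≈γ₁ = left-summand C≈0

      antidiagonal-shape : D * e ≈ 0# → C * f ≉0 → Shape
      antidiagonal-shape De≈0 Cf≉0 = antidiagonal A≈0 D≈0 e≈0 h≈0 B≉0 g≉0 real
        (antidiagonal-entry {A} {B} {C} {D} {e} {f} {g} {h} {u} {w} r₃ D≈0 A≈0 (ᶜ-cong u≈w) real)
        where
        B≉0 : B ≉0
        B≉0 = ᶜ-≉0 (≉0-*ˡ (≉0-resp d₂ Cf≉0))
        g≉0 : g ≉0
        g≉0 = ≉0-*ʳ (≉0-resp d₂ Cf≉0)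
        e≈0 : e ≈ 0#
        e≈0 = *-cancelˡ-0 (≉0-*ˡ Cf≉0) δ₁≈0
        D≈0 : D ≈ 0#
        D≈0 = *-cancelˡ-0 (≉0-*ʳ Cf≉0) (trans (*-comm f D) (kill-sum d₃ δ₁≈0 δ₂≈0))
        A≈0 : A ≈ 0#
        A≈0 = ᶜ-≈0 (*-cancelˡ-0 g≉0 (trans (*-comm g (A ᶜ)) δ₂≈0))
        h≈0 : h ≈ 0#
        h≈0 = *-cancelˡ-0 (≉0-ᶜ B≉0) (kill-sum′ d₄ δ₁≈0 δ₂≈0)
        Cgᶜ≈γ₁ : C * g ᶜ ≈ γ₁
        Cgᶜ≈γ₁ = right-summand A≈0
        real : (C * g ᶜ) ᶜ ≈ C * g ᶜ
        real = trans (ᶜ-cong Cgᶜ≈γ₁) (trans (proj₁ γ₁-real×u≈w) (sym Cgᶜ≈γ₁))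

    -- Since δ₁ = δ₂ = 0, `E₄` reduces to (D e)(C f) = 0, while `E₆` forbids both factors to vanish.
    -- The nonzero one decides the shape.
    shape : Shape
    shape with D * e ≟ 0# | C * f ≟ 0#
    ... | no  De≉0 | yes Cf≈0 = diagonal-shape Cf≈0 De≉0
    ... | yes De≈0 | no  Cf≉0 = antidiagonal-shape De≈0 Cf≉0
    ... | yes De≈0 | yes Cf≈0 =
      contradiction (Λ-vanishes₂ {u} {Λ} {δ₁} {δ₂} {δ₃} {δ₄} E₆ δ₁≈0 δ₂≈0 De≈0 Cf≈0) Λ≉0
    ... | no  De≉0 | no  Cf≉0 = contradiction
      (trans (sym (trans (+-congʳ (trans (*-congʳ δ₁≈0) (zeroˡ _))) (+-identityˡ _))) E₄) (*-≉0 De≉0 Cf≉0)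

-- From an isotopy to two matrices and eight equations

module ProductExpressions where
  open Solver

  mul₁ : (w a b c d : Expr) → Expr
  mul₁ w a b c d = a * c + b * d ᶜ + w * b ᶜ * d

  mul₂ : (a b c d : Expr) → Expr
  mul₂ a b c d = a ᶜ * d + b * c

module IsotopyIdentities {c ℓ : Level} (F : ConjugationRing c ℓ) where
  open Solver
  open ProductExpressions
  open Soundness F

  middle₁ = solve 6 (λ w a p q c d →
    mul₁ w (p * a) (q * a) c d ≈ mul₁ w p q (a * c) (a ᶜ * d) by []) ≡.refl
  middle₂ = solve 5 (λ a p q c d →
    mul₂ (p * a) (q * a) c d ≈ mul₂ p q (a * c) (a ᶜ * d) by []) ≡.refl
  unitʳ₁ = solve 3 (λ w p q → mul₁ w p q 1# 0# ≈ p by []) ≡.refl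
  unitʳ₂ = solve 2 (λ p q → mul₂ p q 1# 0# ≈ q by []) ≡.refl
  unitˡ₁ = solve 3 (λ w c d → mul₁ w 1# 0# c d ≈ c by []) ≡.refl
  unitˡ₂ = solve 2 (λ c d → mul₂ 1# 0# c d ≈ d by []) ≡.refl
  nucleus-second = solve 3 (λ w e f → (w + w ᶜ) * f ᶜ ≈ 0# by
    1# · mul₁ w (mul₁ w 0# 1# e f) (mul₂ 0# 1# e f) w 0# ≈
         mul₁ w 0# 1# (mul₁ w e f w 0#) (mul₂ e f w 0#) ∷ []) ≡.refl
  scalarʳ₁ = solve 5 (λ w p q e f → mul₁ w p q e f ≈ p * e by w * q ᶜ · f ≈ 0# ∷ q · f ᶜ ≈ 0# ᶜ ∷ []) ≡.refl
  scalarʳ₂ = solve 4 (λ p q e f → mul₂ p q e f ≈ q * e by p ᶜ · f ≈ 0# ∷ []) ≡.refl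
  scalarˡ₁ = solve 5 (λ w e f c d → mul₁ w e f c d ≈ e * c by d ᶜ · f ≈ 0# ∷ w * d · f ᶜ ≈ 0# ᶜ ∷ []) ≡.refl
  scalarˡ₂ = solve 4 (λ e f c d → mul₂ e f c d ≈ e ᶜ * d by c · f ≈ 0# ∷ []) ≡.refl
  ⊙-distrib = solve 3 (λ a b d → (a + b) ᶜ * d ≈ a ᶜ * d + b ᶜ * d by []) ≡.refl
  ⊙-assoc = solve 3 (λ a b d → (a * b) ᶜ * d ≈ a ᶜ * (b ᶜ * d) by []) ≡.refl
  1ᶜ* = solve 1 (λ d → 1# ᶜ * d ≈ d by []) ≡.refl

  combineˡ = solve 2 (λ a b → a ≈ 1# * a + 0# * b by []) ≡.refl
  combineʳ = solve 2 (λ a b → b ≈ 0# * a + 1# * b by []) ≡.refl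
  combine⊙ˡ = solve 2 (λ c d → c ≈ c * 1# + d ᶜ * 0# by []) ≡.refl
  combine⊙ʳ = solve 2 (λ c d → d ≈ c ᶜ * 0# + d ᶜ ᶜ * 1# by []) ≡.refl
  times-unit = solve 1 (λ b → b ≈ 1# * b by []) ≡.refl
  times-zero = solve 1 (λ b → 0# ≈ 0# * b by []) ≡.refl

  second-unit₁ = solve 2 (λ v b → mul₁ v 0# b 1# 0# ≈ b ᶜ * 0# by []) ≡.refl
  second-unit₂ = solve 1 (λ b → mul₂ 0# b 1# 0# ≈ b ᶜ ᶜ * 1# by []) ≡.refl
  second-second₁ = solve 2 (λ v b → mul₁ v 0# b 0# 1# ≈ (b + v * b ᶜ) * 1# by []) ≡.refl
  second-second₂ = solve 2 (λ v b → mul₂ 0# b 0# 1# ≈ (b + v * b ᶜ) ᶜ * 0# by []) ≡.refl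

  r₁-scaled = solve 9 (λ w A B C D e f g h → (w + w ᶜ) * (B * e + D * g ᶜ) ≈ (w + w ᶜ) * (w * C ᶜ * h) by
      w ᶜ · mul₁ w (B * 1#) (D * 1#) e g ≈ mul₁ w A C (1# ᶜ * f) (1# ᶜ ᶜ * h)
    ∷ 1# · mul₁ w (B * w) (D * w) e g ≈ mul₁ w A C (w ᶜ * f) (w ᶜ ᶜ * h) ∷ []) ≡.refl
  r₂-scaled = solve 9 (λ w A B C D e f g h → (w + w ᶜ) * (A * f + C * h ᶜ) ≈ (w + w ᶜ) * (w * D ᶜ * g) by
      w · mul₁ w (B * 1#) (D * 1#) e g ≈ mul₁ w A C (1# ᶜ * f) (1# ᶜ ᶜ * h)
    ∷ 1# · mul₁ w (B * w) (D * w) e g ≈ mul₁ w A C (w ᶜ * f) (w ᶜ ᶜ * h) ∷ []) ≡.refl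
  d₁-scaled = solve 9 (λ w A B C D e f g h → (w + w ᶜ) * (D * e) ≈ (w + w ᶜ) * (A ᶜ * h) by
      w ᶜ · mul₂ (B * 1#) (D * 1#) e g ≈ mul₂ A C (1# ᶜ * f) (1# ᶜ ᶜ * h)
    ∷ 1# · mul₂ (B * w) (D * w) e g ≈ mul₂ A C (w ᶜ * f) (w ᶜ ᶜ * h) ∷ []) ≡.refl
  d₂-scaled = solve 9 (λ w A B C D e f g h → (w + w ᶜ) * (C * f) ≈ (w + w ᶜ) * (B ᶜ * g) by
      w · mul₂ (B * 1#) (D * 1#) e g ≈ mul₂ A C (1# ᶜ * f) (1# ᶜ ᶜ * h)
    ∷ 1# · mul₂ (B * w) (D * w) e g ≈ mul₂ A C (w ᶜ * f) (w ᶜ ᶜ * h) ∷ []) ≡.refl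
  r₃-scaled = solve 10 (λ w A B C D e f g h u →
    (w + w ᶜ) * (B * f + D * h ᶜ) ≈ (w + w ᶜ) * ((A * e + C * g ᶜ) + u ᶜ * (w * C ᶜ * g)) by
      w ᶜ · mul₁ w (B * 1#) (D * 1#) f h ≈ mul₁ w A C ((1# + u * 1# ᶜ) * e) ((1# + u * 1# ᶜ) ᶜ * g)
    ∷ 1# · mul₁ w (B * w) (D * w) f h ≈ mul₁ w A C ((w + u * w ᶜ) * e) ((w + u * w ᶜ) ᶜ * g) ∷ []) ≡.refl
  r₄-scaled = solve 10 (λ w A B C D e f g h u →
    (w + w ᶜ) * (w * D ᶜ * h) ≈ (w + w ᶜ) * (u * (A * e + C * g ᶜ) + w * C ᶜ * g) by
      w · mul₁ w (B * 1#) (D * 1#) f h ≈ mul₁ w A C ((1# + u * 1# ᶜ) * e) ((1# + u * 1# ᶜ) ᶜ * g)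
    ∷ 1# · mul₁ w (B * w) (D * w) f h ≈ mul₁ w A C ((w + u * w ᶜ) * e) ((w + u * w ᶜ) ᶜ * g) ∷ []) ≡.refl
  d₃-scaled = solve 10 (λ w A B C D e f g h u →
    (w + w ᶜ) * (D * f) ≈ (w + w ᶜ) * (C * e + u ᶜ * (A ᶜ * g)) by
      w ᶜ · mul₂ (B * 1#) (D * 1#) f h ≈ mul₂ A C ((1# + u * 1# ᶜ) * e) ((1# + u * 1# ᶜ) ᶜ * g)
    ∷ 1# · mul₂ (B * w) (D * w) f h ≈ mul₂ A C ((w + u * w ᶜ) * e) ((w + u * w ᶜ) ᶜ * g) ∷ []) ≡.refl
  d₄-scaled = solve 10 (λ w A B C D e f g h u →
    (w + w ᶜ) * (B ᶜ * h) ≈ (w + w ᶜ) * (u * (C * e) + A ᶜ * g) by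
      w · mul₂ (B * 1#) (D * 1#) f h ≈ mul₂ A C ((1# + u * 1# ᶜ) * e) ((1# + u * 1# ᶜ) ᶜ * g)
    ∷ 1# · mul₂ (B * w) (D * w) f h ≈ mul₂ A C ((w + u * w ᶜ) * e) ((w + u * w ᶜ) ᶜ * g) ∷ []) ≡.refl

  det₁ = solve 8 (λ A B C D p r p′ r′ → (A * D + B * C) * (p * r′ + r * p′) ≈ 1# by
      C * p′ + D * r′ · A * p + B * r ≈ 1# ∷ 1# · C * p′ + D * r′ ≈ 1#
    ∷ C * p + D * r · A * p′ + B * r′ ≈ 0# ∷ []) ≡.refl
  det₂ = solve 8 (λ e f g h s t s′ t′ → (e * h ᶜ + f * g ᶜ) * (s * t′ + t * s′) ≈ 1# by
      (s′ ᶜ * g + t′ ᶜ * h) ᶜ · s * e + t * f ≈ 1# ∷ 1# · (s′ ᶜ * g + t′ ᶜ * h) ᶜ ≈ 1# ᶜ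
    ∷ (s ᶜ * g + t ᶜ * h) ᶜ · s′ * e + t′ * f ≈ 0# ∷ []) ≡.refl

module Semifields {c ℓ : Level} (K : ConjugationField c ℓ) where

  open ConjugationField K
  open FieldProperties K
  open IsotopyIdentities conjugationRing

  L×L : AbelianGroup c ℓ
  L×L = DirectProduct.abelianGroup +-abelianGroup +-abelianGroup

  open Isotopism L×L
  open AbelianGroup L×L using () renaming (_≈_ to _≋_; trans to ≋-trans; sym to ≋-sym; refl to ≋-refl)

  Point : Set c
  Point = Carrier × Carrier

  -- This is FiniteField.B q when _ᶜ is _^ q.
  mul : Carrier → Op₂ Point
  mul w (a , b) (c , d) =
    (a * c + b * d ᶜ + w * b ᶜ * d) , (a ᶜ * d + b * c)

  mul-cong : ∀ w {x x′ y y′} → x ≋ x′ → y ≋ y′ → mul w x y ≋ mul w x′ y′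
  mul-cong w (a , b) (c , d) =
    +-cong (+-cong (*-cong a c) (*-cong b (ᶜ-cong d))) (*-cong (*-congˡ (ᶜ-cong b)) d) ,
    +-cong (*-cong (ᶜ-cong a) d) (*-cong b c)

  infixl 8 _·ʳ_
  infixr 8 _⊙_

  -- `x ·ʳ a` is x ⋆ (a , 0) and `a ⊙ y` is (a , 0) ⋆ y, the same in every B(w).
  _·ʳ_ : Point → Carrier → Point
  (p , q) ·ʳ a = p * a , q * a

  _⊙_ : Carrier → Point → Point
  a ⊙ (c , d) = a * c , a ᶜ * d

  ·ʳ-cong : ∀ {x y a b} → x ≋ y → a ≈ b → x ·ʳ a ≋ y ·ʳ b
  ·ʳ-cong (p , q) r = *-cong p r , *-cong q r

  ⊙-cong : ∀ {a b x y} → a ≈ b → x ≋ y → a ⊙ x ≋ b ⊙ y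
  ⊙-cong r (p , q) = *-cong r p , *-cong (ᶜ-cong r) q

  e₁ e₂ : Point
  e₁ = 1# , 0#
  e₂ = 0# , 1#

  -‿id : ∀ x → - x ≈ x
  -‿id x = x+y≈0⇒x≈y (-‿inverseˡ x)

  -- A nonzero x + y with f x = f y would be invertible and force 1 = 0, so f is injective;
  -- finiteness, as `injective⇒surjective`, does the rest.
  automorphism : (f : Carrier → Carrier) → Congruent _≈_ _≈_ f →
    (∀ x y → f (x + y) ≈ f x + f y) → (∀ x y → f (x * y) ≈ f x * f y) → f 1# ≈ 1# → Automorphism
  automorphism f f-cong f-+ f-* f-1 = record
    { ⟦_⟧ = f
    ; isRingIsomorphism = record
      { isRingMonomorphism = record
        { isRingHomomorphism = record
          { isSemiringHomomorphism = record
            { isNearSemiringHomomorphism = record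
              { +-isMonoidHomomorphism = record
                { isMagmaHomomorphism = record
                  { isRelHomomorphism = record { cong = f-cong }
                  ; homo = f-+
                  }
                ; ε-homo = f-0
                }
              ; *-homo = f-*
              }
            ; 1#-homo = f-1
            }
          ; -‿homo = λ x → trans (f-cong (-‿id x)) (sym (-‿id (f x)))
          }
        ; injective = f-injective
        }
      ; surjective = injective⇒surjective f-cong f-injective
      }
    }
    where
    f-0 : f 0# ≈ 0#
    f-0 = trans (f-cong (sym (+-identityˡ 0#))) (trans (f-+ 0# 0#) (x+x≈0 (f 0#)))
    f-injective : Injective _≈_ _≈_ f
    f-injective {x} {y} fx≈fy with x + y ≟ 0#
    ... | yes p = x+y≈0⇒x≈y p
    ... | no  p = contradiction 1≈0 1≉0
      where
      z = proj₁ (inverse p)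
      1≈0 : 1# ≈ 0#
      1≈0 = trans (sym f-1) (trans (f-cong (sym (proj₂ (inverse p)))) (trans (f-* (x + y) z)
        (trans (*-congʳ (trans (f-+ x y) (x≈y⇒x+y≈0 fx≈fy))) (zeroˡ (f z)))))

  module IsotopyShape {w v : Carrier} (wᶜ≉w : ¬ w ᶜ ≈ w) (I : Isotopy (mul w) (mul v)) where

    private
      module I = Isotopy I
      module α₁ = AdditiveBijection I.α₁
      module α₂ = AdditiveBijection I.α₂
      module β = AdditiveBijection I.β

    α₁ α₂ : Point → Point
    α₁ = α₁.⟦_⟧
    α₂ = α₂.⟦_⟧

    private
      preimage₁ : ∀ y → ∃ λ x → α₁ x ≋ y
      preimage₁ y = proj₁ (α₁.surjective y) , proj₂ (α₁.surjective y) ≋-refl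

      preimage₂ : ∀ y → ∃ λ x → α₂ x ≋ y
      preimage₂ y = proj₁ (α₂.surjective y) , proj₂ (α₂.surjective y) ≋-refl

      middle : ∀ a x y → mul v (x ·ʳ a) y ≋ mul v x (a ⊙ y)
      middle a x y = middle₁ , middle₂

      -- The pair (a , 0) associates as a middle factor in B(v), and cancelling β carries this over
      -- to B(w).
      transfer : ∀ a x y → mul w (α₁ (x ·ʳ a)) (α₂ y) ≋ mul w (α₁ x) (α₂ (a ⊙ y))
      transfer a x y = β.injective (≋-trans (I.isotopy (x ·ʳ a) y)
        (≋-trans (middle a x y) (≋-sym (I.isotopy x (a ⊙ y)))))

      x₁ y₁ : Point
      x₁ = proj₁ (preimage₁ e₁)
      y₁ = proj₁ (preimage₂ e₁)

      -- Because α₂ sends `y₁` to the identity, `m a` is the element of B(w) that corresponds to the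
      -- middle factor (a , 0).
      m : Carrier → Point
      m a = α₂ (a ⊙ y₁)

      α₁-m : ∀ a x → α₁ (x ·ʳ a) ≋ mul w (α₁ x) (m a)
      α₁-m a x = ≋-trans (≋-sym (unitʳ₁ , unitʳ₂))
        (≋-trans (mul-cong w ≋-refl (≋-sym (proj₂ (preimage₂ e₁)))) (transfer a x y₁))

      α₂-m : ∀ a y → α₂ (a ⊙ y) ≋ mul w (m a) (α₂ y)
      α₂-m a y = ≋-trans (≋-sym (unitˡ₁ , unitˡ₂))
        (≋-trans (mul-cong w (≋-sym (proj₂ (preimage₁ e₁))) ≋-refl)
        (≋-trans (≋-sym (transfer a x₁ y))
        (mul-cong w (≋-trans (α₁-m a x₁)
          (≋-trans (mul-cong w (proj₂ (preimage₁ e₁)) ≋-refl) (unitˡ₁ , unitˡ₂))) ≋-refl)))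

      m-middle : ∀ a x y → mul w (mul w x (m a)) y ≋ mul w x (mul w (m a) y)
      m-middle a x y =
        ≋-trans (mul-cong w (mul-cong w (≋-sym x≋) ≋-refl) (≋-sym y≋))
        (≋-trans (mul-cong w (≋-sym (α₁-m a x′)) ≋-refl)
        (≋-trans (transfer a x′ y′)
        (≋-trans (mul-cong w ≋-refl (α₂-m a y′))
        (mul-cong w x≋ (mul-cong w ≋-refl y≋)))))
        where
        x′ = proj₁ (preimage₁ x)
        x≋ = proj₂ (preimage₁ x)
        y′ = proj₁ (preimage₂ y)
        y≋ = proj₂ (preimage₂ y)

      w+wᶜ≉0 : w + w ᶜ ≉0
      w+wᶜ≉0 p = wᶜ≉w (sym (x+y≈0⇒x≈y p))

      -- m a lies in the middle nucleus, whose elements are the pairs (e , 0).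
      m-second : ∀ a → proj₂ (m a) ≈ 0#
      m-second a = ᶜ-≈0 (*-cancelˡ-0 w+wᶜ≉0 (nucleus-second (proj₁ (m-middle a e₂ (w , 0#)))))

      φ : Carrier → Carrier
      φ a = proj₁ (m a)

    α₁-φ : ∀ a x → α₁ (x ·ʳ a) ≋ α₁ x ·ʳ φ a
    α₁-φ a x = ≋-trans (α₁-m a x) (scalarʳ₁ (m-second a) (ᶜ-cong (m-second a)) , scalarʳ₂ (m-second a))

    α₂-φ : ∀ a y → α₂ (a ⊙ y) ≋ φ a ⊙ α₂ y
    α₂-φ a y = ≋-trans (α₂-m a y) (scalarˡ₁ (m-second a) (ᶜ-cong (m-second a)) , scalarˡ₂ (m-second a))

    Φ : Automorphism
    Φ = automorphism φ
      (λ a≈b → proj₁ (α₂.cong (⊙-cong a≈b ≋-refl)))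
      (λ a b → proj₁ (≋-trans (α₂.cong (distribʳ _ a b , ⊙-distrib)) (α₂.homo (a ⊙ y₁) (b ⊙ y₁))))
      (λ a b → proj₁ (≋-trans (α₂.cong (*-assoc a b _ , ⊙-assoc)) (α₂-φ a (b ⊙ y₁))))
      (proj₁ (≋-trans (α₂.cong (*-identityˡ _ , 1ᶜ*)) (proj₂ (preimage₂ e₁))))

    private module Φ = Automorphism Φ

    A B C D e f g h u : Carrier
    A = proj₁ (α₁ e₁)
    C = proj₂ (α₁ e₁)
    B = proj₁ (α₁ e₂)
    D = proj₂ (α₁ e₂)
    e = proj₁ (α₂ e₁)
    g = proj₂ (α₂ e₁)
    f = proj₁ (α₂ e₂)
    h = proj₂ (α₂ e₂)
    u = φ v

    α₁-form : ∀ x → α₁ x ≋ (A * φ (proj₁ x) + B * φ (proj₂ x) , C * φ (proj₁ x) + D * φ (proj₂ x))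
    α₁-form (a , b) = ≋-trans (α₁.cong (combineˡ , combineʳ))
      (≋-trans (α₁.homo (e₁ ·ʳ a) (e₂ ·ʳ b))
      (+-cong (proj₁ (α₁-φ a e₁)) (proj₁ (α₁-φ b e₂)) , +-cong (proj₂ (α₁-φ a e₁)) (proj₂ (α₁-φ b e₂))))

    α₂-form : ∀ y → α₂ y ≋ ( φ (proj₁ y) * e + φ (proj₂ y ᶜ) * f
                            , φ (proj₁ y) ᶜ * g + φ (proj₂ y ᶜ) ᶜ * h )
    α₂-form (a , b) = ≋-trans (α₂.cong (combine⊙ˡ , combine⊙ʳ))
      (≋-trans (α₂.homo (a ⊙ e₁) (b ᶜ ⊙ e₂))
      ( +-cong (proj₁ (α₂-φ a e₁)) (proj₁ (α₂-φ (b ᶜ) e₂))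
      , +-cong (proj₂ (α₂-φ a e₁)) (proj₂ (α₂-φ (b ᶜ) e₂))))

    private
      -- In B(v) the product of x and y equals e₁ times that product; applying the isotopy to both
      -- forms eliminates β.
      key : ∀ x y → mul w (α₁ x) (α₂ y) ≋ mul w (α₁ e₁) (α₂ (mul v x y))
      key x y = β.injective (≋-trans (I.isotopy x y)
        (≋-sym (≋-trans (I.isotopy e₁ (mul v x y)) (unitˡ₁ , unitˡ₂))))

      α₁-second : ∀ {b b′} → φ b ≈ b′ → α₁ (0# , b) ≋ (B * b′ , D * b′)
      α₁-second {b} p = ≋-trans (α₁.cong (times-zero , times-unit))
        (≋-trans (α₁-φ b e₂) (·ʳ-cong ≋-refl p))

      φ-ᶜ : ∀ {b b′} → φ b ≈ b′ → φ (b ᶜ) ≈ b′ ᶜ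
      φ-ᶜ p = trans (⟦⟧-ᶜ Φ _) (ᶜ-cong p)

      -- In B(v), (0 , b) ⋆ e₁ = bᶜ ⊙ e₂ and (0 , b) ⋆ e₂ = (b + v bᶜ) ⊙ e₁, both of which `α₂-φ`
      -- evaluates. As φ is onto, b′ = φ b is arbitrary.
      key₁ : ∀ b′ → mul w (B * b′ , D * b′) (e , g) ≋ mul w (A , C) (b′ ᶜ * f , b′ ᶜ ᶜ * h)
      key₁ b′ = ≋-trans (mul-cong w (≋-sym (α₁-second φb≈b′)) ≋-refl)
        (≋-trans (key (0# , b) e₁)
        (mul-cong w ≋-refl (≋-trans (α₂.cong (second-unit₁ , second-unit₂))
          (≋-trans (α₂-φ (b ᶜ) e₂) (⊙-cong (φ-ᶜ φb≈b′) ≋-refl)))))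
        where
        b = proj₁ (Φ.surjective b′)
        φb≈b′ : φ b ≈ b′
        φb≈b′ = proj₂ (Φ.surjective b′) refl

      key₂ : ∀ b′ → mul w (B * b′ , D * b′) (f , h) ≋
                    mul w (A , C) ((b′ + u * b′ ᶜ) * e , (b′ + u * b′ ᶜ) ᶜ * g)
      key₂ b′ = ≋-trans (mul-cong w (≋-sym (α₁-second φb≈b′)) ≋-refl)
        (≋-trans (key (0# , b) e₂)
        (mul-cong w ≋-refl (≋-trans (α₂.cong (second-second₁ , second-second₂))
          (≋-trans (α₂-φ (b + v * b ᶜ) e₁) (⊙-cong φξ ≋-refl)))))
        where
        b = proj₁ (Φ.surjective b′)
        φb≈b′ : φ b ≈ b′
        φb≈b′ = proj₂ (Φ.surjective b′) refl
        φξ : φ (b + v * b ᶜ) ≈ b′ + u * b′ ᶜ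
        φξ = trans (Φ.+-homo b (v * b ᶜ))
          (+-cong φb≈b′ (trans (Φ.*-homo v (b ᶜ)) (*-congˡ (φ-ᶜ φb≈b′))))

    -- As wᶜ ≠ w, the coefficients of b′ and b′ᶜ in key₁ and key₂ are determined by the
    -- cases b′ = 1 and b′ = w.
    r₁ : B * e + D * g ᶜ ≈ w * C ᶜ * h
    r₁ = *-cancelˡ w+wᶜ≉0 (r₁-scaled {w} {A} {B} {C} {D} {e} {f} {g} {h} (proj₁ (key₁ 1#)) (proj₁ (key₁ w)))

    r₂ : A * f + C * h ᶜ ≈ w * D ᶜ * g
    r₂ = *-cancelˡ w+wᶜ≉0 (r₂-scaled {w} {A} {B} {C} {D} {e} {f} {g} {h} (proj₁ (key₁ 1#)) (proj₁ (key₁ w)))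

    r₃ : B * f + D * h ᶜ ≈ (A * e + C * g ᶜ) + u ᶜ * (w * C ᶜ * g)
    r₃ = *-cancelˡ w+wᶜ≉0 (r₃-scaled {w} {A} {B} {C} {D} {e} {f} {g} {h} {u} (proj₁ (key₂ 1#)) (proj₁ (key₂ w)))

    r₄ : w * D ᶜ * h ≈ u * (A * e + C * g ᶜ) + w * C ᶜ * g
    r₄ = *-cancelˡ w+wᶜ≉0 (r₄-scaled {w} {A} {B} {C} {D} {e} {f} {g} {h} {u} (proj₁ (key₂ 1#)) (proj₁ (key₂ w)))

    d₁ : D * e ≈ A ᶜ * h
    d₁ = *-cancelˡ w+wᶜ≉0 (d₁-scaled {w} {A} {B} {C} {D} {e} {f} {g} {h} (proj₂ (key₁ 1#)) (proj₂ (key₁ w)))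

    d₂ : C * f ≈ B ᶜ * g
    d₂ = *-cancelˡ w+wᶜ≉0 (d₂-scaled {w} {A} {B} {C} {D} {e} {f} {g} {h} (proj₂ (key₁ 1#)) (proj₂ (key₁ w)))

    d₃ : D * f ≈ C * e + u ᶜ * (A ᶜ * g)
    d₃ = *-cancelˡ w+wᶜ≉0 (d₃-scaled {w} {A} {B} {C} {D} {e} {f} {g} {h} {u} (proj₂ (key₂ 1#)) (proj₂ (key₂ w)))

    d₄ : B ᶜ * h ≈ u * (C * e) + A ᶜ * g
    d₄ = *-cancelˡ w+wᶜ≉0 (d₄-scaled {w} {A} {B} {C} {D} {e} {f} {g} {h} {u} (proj₂ (key₂ 1#)) (proj₂ (key₂ w)))

    private
      ≈1⇒≉0 : ∀ {x y} → x * y ≈ 1# → x ≉0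
      ≈1⇒≉0 xy≈1 x≈0 = 1≉0 (trans (sym xy≈1) (trans (*-congʳ x≈0) (zeroˡ _)))

      α₁-solve : ∀ y → ∃ λ p → ∃ λ r → (A * p + B * r , C * p + D * r) ≋ y
      α₁-solve y = let (x , x≋) = preimage₁ y in
        φ (proj₁ x) , φ (proj₂ x) , ≋-trans (≋-sym (α₁-form x)) x≋

      α₂-solve : ∀ y → ∃ λ s → ∃ λ t → (s * e + t * f , s ᶜ * g + t ᶜ * h) ≋ y
      α₂-solve y = let (x , x≋) = preimage₂ y in
        φ (proj₁ x) , φ (proj₂ x ᶜ) , ≋-trans (≋-sym (α₂-form x)) x≋

    -- Preimages of `e₁` and `e₂` supply an inverse matrix, whose determinant is inverse to this
    -- one.
    AD+BC≉0 : A * D + B * C ≉0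
    AD+BC≉0 =
      let (_ , _ , p≋) = α₁-solve e₁
          (_ , _ , q≋) = α₁-solve e₂
      in ≈1⇒≉0 (det₁ (proj₁ p≋) (proj₂ q≋) (proj₁ q≋))

    ehᶜ+fgᶜ≉0 : e * h ᶜ + f * g ᶜ ≉0
    ehᶜ+fgᶜ≉0 =
      let (_ , _ , p≋) = α₂-solve e₁
          (_ , _ , q≋) = α₂-solve e₂
      in ≈1⇒≉0 (det₂ (proj₁ p≋) (ᶜ-cong (proj₂ q≋)) (proj₁ q≋))

-- Constructing and classifying the autotopisms

module AutotopismIdentities {c ℓ : Level} (F : ConjugationRing c ℓ) where
  open Solver
  open ProductExpressions
  open Soundness F

  scale-cancel = solve 3 (λ p x a → p * (x * a) ≈ a by a · p * x ≈ 1# ∷ []) ≡.refl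
  scale-cancel′ = solve 3 (λ p x a → x * (p * a) ≈ a by a · p * x ≈ 1# ∷ []) ≡.refl

  norm-product-real = solve 2 (λ P Q → (P * P ᶜ * (Q * Q ᶜ)) ᶜ ≈ P * P ᶜ * (Q * Q ᶜ) by []) ≡.refl
  1+norm-real = solve 1 (λ w → (1# + w * w ᶜ) ᶜ ≈ 1# + w * w ᶜ by []) ≡.refl
  real-root = solve 2 (λ k x → k ᶜ * k ᶜ ≈ k * k by 1# · k * k ≈ x ∷ 1# · (k * k) ᶜ ≈ x ᶜ ∷ 1# · x ᶜ ≈ x ∷ []) ≡.refl
  quotient = solve 3 (λ k x p → k * x * p ≈ k by k · p * x ≈ 1# ∷ []) ≡.refl

  diagonal₁ = solve 10 (λ w P Q D e k a b c d →
    mul₁ w (P * a) (D * b) (e * c) (Q * d) ≈ k * mul₁ w a b c d by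
      a * c · e * P ≈ k ∷ b * d ᶜ · D * Q ᶜ ≈ k ∷ w * b ᶜ * d · (D * Q ᶜ) ᶜ ≈ k ᶜ
    ∷ w * b ᶜ * d · k ᶜ ≈ k ∷ []) ≡.refl
  diagonal₂ = solve 8 (λ P Q D e a b c d →
    mul₂ (P * a) (D * b) (e * c) (Q * d) ≈ P ᶜ * Q * mul₂ a b c d by
      b * c · D * e ≈ P ᶜ * Q ∷ []) ≡.refl
  diagonal-entries = solve 5 (λ P Q D e k → P * Q ᶜ * (D * e) ≈ P * Q ᶜ * (P ᶜ * Q) by
      e * P · D * Q ᶜ ≈ k ∷ k · e * P ≈ k ∷ 1# · k * k ≈ P * P ᶜ * (Q * Q ᶜ) ∷ []) ≡.refl

  twist₁ = solve 6 (λ w ρ a b c d →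
    mul₁ w (ρ * b) a (ρ * d ᶜ) (c ᶜ) ≈ mul₁ w a b c d + w * mul₁ w a b c d ᶜ by
      b * d ᶜ · ρ * ρ ≈ 1# + w * w ᶜ ∷ []) ≡.refl
  twist₂ = solve 5 (λ ρ a b c d →
    mul₂ (ρ * b) a (ρ * d ᶜ) (c ᶜ) ≈ ρ * mul₂ a b c d ᶜ by b ᶜ * c ᶜ · ρ ᶜ ≈ ρ ∷ []) ≡.refl
  twist-additive = solve 3 (λ w x y → (x + y) + w * (x + y) ᶜ ≈ (x + w * x ᶜ) + (y + w * y ᶜ) by []) ≡.refl
  twist-inverse = solve 3 (λ w n x → n * (x + w * x ᶜ) + w * (n * (x + w * x ᶜ)) ᶜ ≈ x by
      w * (x + w * x ᶜ) ᶜ · n ᶜ ≈ n ∷ x · (1# + w * w ᶜ) * n ≈ 1# ∷ []) ≡.refl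
  twist-inverse′ = solve 3 (λ w n x → n * ((x + w * x ᶜ) + w * (x + w * x ᶜ) ᶜ) ≈ x by
      x · (1# + w * w ᶜ) * n ≈ 1# ∷ []) ≡.refl
  real-inverse = solve 2 (λ r n → r * n ᶜ ≈ r * n by
      1# · r * n ≈ 1# ∷ 1# · (r * n) ᶜ ≈ 1# ᶜ ∷ n ᶜ · r ᶜ ≈ r ∷ []) ≡.refl
  scaledᶜ-additive = solve 3 (λ r x y → r * (x + y) ᶜ ≈ r * x ᶜ + r * y ᶜ by []) ≡.refl
  ᶜ-scale-cancel = solve 3 (λ r s x → r * (s ᶜ * x ᶜ) ᶜ ≈ x by x · r * s ≈ 1# ∷ []) ≡.refl
  ᶜ-scale-cancel′ = solve 3 (λ r s x → s ᶜ * (r * x ᶜ) ᶜ ≈ x by x · (r * s) ᶜ ≈ 1# ᶜ ∷ []) ≡.refl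

  module Matching where
    -- The dependent entries are matched by their squares: A e, respectively C gᶜ, has the square
    -- N(P)N(Q) that defines k.
    diagonal-root = solve 4 (λ A D e h → A * e * (A * e) ≈ A * A ᶜ * (h * h ᶜ) by
      A * e · D * h ᶜ ≈ A * e ∷ A * h ᶜ · D * e ≈ A ᶜ * h ∷ []) ≡.refl
    antidiagonal-root = solve 7 (λ w ρ B C f g P → (ρ * ρ) * (C * g ᶜ * (C * g ᶜ)) ≈ (ρ * ρ) * (P * P ᶜ * (g * g ᶜ)) by
        C * g ᶜ · B * f ≈ (1# + w * w ᶜ) * (C * g ᶜ)
      ∷ C * g ᶜ * (C * g ᶜ) · ρ * ρ ≈ 1# + w * w ᶜ ∷ B * g ᶜ · C * f ≈ B ᶜ * g
      ∷ B ᶜ * g * g ᶜ · B ≈ P * ρ ∷ P * ρ * g * g ᶜ · B ᶜ ≈ (P * ρ) ᶜ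
      ∷ P * ρ * P ᶜ * g * g ᶜ · ρ ᶜ ≈ ρ ∷ []) ≡.refl
    antidiagonal-factor = solve 8 (λ w ρ B f P e k κ → B * (e * ρ) ≈ B * f by
        1# · B * f ≈ (1# + w * w ᶜ) * κ ∷ κ · ρ * ρ ≈ 1# + w * w ᶜ
      ∷ e * ρ · B ≈ P * ρ ∷ ρ * ρ · e * P ≈ k ∷ ρ * ρ · k ≈ κ ∷ []) ≡.refl
    keep-first = solve 4 (λ A B x y → A * x + B * y ≈ A * x by y · B ≈ 0# ∷ []) ≡.refl
    keep-second = solve 5 (λ C D D′ x y → C * x + D * y ≈ D′ * y by x · C ≈ 0# ∷ y · D ≈ D′ ∷ []) ≡.refl
    keep-first⊙ = solve 5 (λ e e′ f x y → x * e + y * f ≈ e′ * x by x · e ≈ e′ ∷ y · f ≈ 0# ∷ []) ≡.refl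
    keep-second⊙ = solve 5 (λ g h x y z → x * g + y ᶜ * h ≈ h * z by x · g ≈ 0# ∷ h · y ᶜ ≈ z ᶜ ᶜ ∷ []) ≡.refl
    swap-first = solve 6 (λ A B P ρ x y → A * x + B * y ≈ P * (ρ * y) by x · A ≈ 0# ∷ y · B ≈ P * ρ ∷ []) ≡.refl
    swap-second = solve 5 (λ C C′ D x y → C * x + D * y ≈ C′ * x by y · D ≈ 0# ∷ x · C ≈ C′ ∷ []) ≡.refl
    swap-first⊙ = solve 7 (λ e f e′ ρ x y z → x * e + y * f ≈ e′ * (ρ * z) by x · e ≈ 0# ∷ y · e′ * ρ ≈ f ∷ e′ * ρ · y ≈ z ∷ []) ≡.refl
    swap-second⊙ = solve 4 (λ g h x y → x ᶜ * g + y ᶜ * h ≈ g * x ᶜ by y ᶜ · h ≈ 0# ∷ []) ≡.refl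

  pick-first = solve 2 (λ A x → A * x ≈ A by A · x ≈ 1# ∷ []) ≡.refl

module Autotopy {c ℓ : Level} (K : ConjugationField c ℓ) where

  open ConjugationField K
  open FieldProperties K
  private F = conjugationRing
  open Semifields K

  open Isotopism L×L
  open AbelianGroup L×L using () renaming (_≈_ to _≋_; _∙_ to _⊕_; trans to ≋-trans; sym to ≋-sym; refl to ≋-refl)

  open AutotopismIdentities F

  additiveBijection : (f f⁻¹ : Point → Point) →
    (∀ {x y} → x ≋ y → f x ≋ f y) → (∀ {x y} → x ≋ y → f⁻¹ x ≋ f⁻¹ y) →
    (∀ x y → f (x ⊕ y) ≋ f x ⊕ f y) → (∀ x → f (f⁻¹ x) ≋ x) → (∀ x → f⁻¹ (f x) ≋ x) →
    AdditiveBijection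
  additiveBijection f f⁻¹ f-cong f⁻¹-cong f-homo f∘f⁻¹ f⁻¹∘f = record
    { ⟦_⟧ = f
    ; isMagmaIsomorphism = record
      { isMagmaMonomorphism = record
        { isMagmaHomomorphism = record
          { isRelHomomorphism = record { cong = f-cong }
          ; homo = f-homo
          }
        ; injective = λ {x} {y} e → ≋-trans (≋-sym (f⁻¹∘f x)) (≋-trans (f⁻¹-cong e) (f⁻¹∘f y))
        }
      ; surjective = λ y → f⁻¹ y , λ z≋ → ≋-trans (f-cong z≋) (f∘f⁻¹ y)
      }
    }

  open AdditiveBijection using (⟦_⟧)

  isotopy-by : ∀ {w v} (α₁ α₂ G : AdditiveBijection) →
    (∀ x y → mul w (⟦ α₁ ⟧ x) (⟦ α₂ ⟧ y) ≋ ⟦ G ⟧ (mul v x y)) → Isotopy (mul w) (mul v)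
  isotopy-by {w} {v} α₁ α₂ G eq = record
    { α₁ = α₁
    ; α₂ = α₂
    ; β = G ⁻¹ᵇ
    ; isotopy = λ x y → G.injective (≋-trans (proj₂ (G.surjective _) ≋-refl) (eq x y))
    }
    where module G = AdditiveBijection G

  scaleᵇ : ∀ {p q} → p ≉0 → q ≉0 → AdditiveBijection
  scaleᵇ {p} {q} p≉0 q≉0 = additiveBijection
    (λ (x , y) → p * x , q * y) (λ (x , y) → p⁻¹ * x , q⁻¹ * y)
    (λ (a , b) → *-congˡ a , *-congˡ b) (λ (a , b) → *-congˡ a , *-congˡ b)
    (λ _ _ → distribˡ p _ _ , distribˡ q _ _)
    (λ _ → scale-cancel pp⁻¹ , scale-cancel qq⁻¹)
    (λ _ → scale-cancel′ pp⁻¹ , scale-cancel′ qq⁻¹)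
    where
    p⁻¹ = proj₁ (inverse p≉0)
    pp⁻¹ = proj₂ (inverse p≉0)
    q⁻¹ = proj₁ (inverse q≉0)
    qq⁻¹ = proj₂ (inverse q≉0)

  galoisᵇ : Automorphism → AdditiveBijection
  galoisᵇ φ = additiveBijection
    (λ (x , y) → ⟦φ⟧ x , ⟦φ⟧ y) (λ (x , y) → ⟦φ⁻¹⟧ x , ⟦φ⁻¹⟧ y)
    (λ (a , b) → φ.cong a , φ.cong b) (λ (a , b) → φ⁻¹.cong a , φ⁻¹.cong b)
    (λ _ _ → φ.+-homo _ _ , φ.+-homo _ _)
    (λ _ → Group.inverseʳ galoisGroup φ _ , Group.inverseʳ galoisGroup φ _)
    (λ _ → Group.inverseˡ galoisGroup φ _ , Group.inverseˡ galoisGroup φ _)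
    where
    module φ = Automorphism φ
    module φ⁻¹ = Automorphism (Group._⁻¹ galoisGroup φ)
    ⟦φ⟧ = φ.⟦_⟧
    ⟦φ⁻¹⟧ = φ⁻¹.⟦_⟧

  galois-isotopy : ∀ {w v} φ → w ≈ Automorphism.⟦ φ ⟧ v → Isotopy (mul w) (mul v)
  galois-isotopy {w} {v} φ w≈φv = isotopy-by (galoisᵇ φ) (galoisᵇ φ) (galoisᵇ φ) λ (a , b) (c , d) →
    sym (trans (φ.+-homo _ _) (+-cong (trans (φ.+-homo _ _)
        (+-cong (φ.*-homo a c) (φ-*ᶜ b d)))
        (trans (φ.*-homo _ d) (*-congʳ (trans (φ-*ᶜ v b) (*-congʳ (sym w≈φv))))))) ,
    sym (trans (φ.+-homo _ _) (+-cong (trans (φ.*-homo _ d) (*-congʳ (⟦⟧-ᶜ φ a))) (φ.*-homo b c)))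
    where
    module φ = Automorphism φ
    φ-*ᶜ : ∀ x y → φ.⟦_⟧ (x * y ᶜ) ≈ φ.⟦_⟧ x * φ.⟦_⟧ y ᶜ
    φ-*ᶜ x y = trans (φ.*-homo x (y ᶜ)) (*-congˡ (⟦⟧-ᶜ φ y))

  -- This is all that the classification draws from the trace condition.
  Nondegenerate : Carrier → Set ℓ
  Nondegenerate w = ¬ w ᶜ ≈ w × ¬ w * w ᶜ ≈ 1#

  nondegenerate-image : ∀ {v} φ → Nondegenerate v → Nondegenerate (Automorphism.⟦ φ ⟧ v)
  nondegenerate-image {v} φ (vᶜ≉v , vvᶜ≉1) =
    (λ p → vᶜ≉v (φ.injective (trans (⟦⟧-ᶜ φ v) p))) ,
    (λ p → vvᶜ≉1 (φ.injective (trans (φ.*-homo v (v ᶜ))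
      (trans (*-congˡ (⟦⟧-ᶜ φ v)) (trans p (sym φ.1#-homo))))))
    where module φ = Automorphism φ

  module Classified {w v : Carrier} (w-nd : Nondegenerate w) (v-nd : Nondegenerate v)
    (I : Isotopy (mul w) (mul v)) where
    open IsotopyShape (proj₁ w-nd) I public
    open Pencil r₁ r₂ r₃ r₄ d₁ d₂ d₃ d₄ AD+BC≉0 ehᶜ+fgᶜ≉0 (proj₁ w-nd)
      (proj₁ (nondegenerate-image Φ v-nd)) (proj₂ (nondegenerate-image Φ v-nd)) public

  isotopic⇒conjugate : ∀ {w v} → Nondegenerate w → Nondegenerate v →
    Isotopy (mul w) (mul v) → ∃ λ φ → v ≈ Automorphism.⟦ φ ⟧ w
  isotopic⇒conjugate {w} {v} w-nd v-nd I = Φ⁻¹ ,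
    trans (sym (Group.inverseˡ galoisGroup Φ v)) (Automorphism.cong Φ⁻¹ u≈w)
    where
    open Classified w-nd v-nd I
    Φ⁻¹ = Group._⁻¹ galoisGroup Φ

  conjugate⇒isotopic : ∀ {w v} → (∃ λ φ → v ≈ Automorphism.⟦ φ ⟧ w) → Isotopy (mul w) (mul v)
  conjugate⇒isotopic {w} {v} (φ , v≈φw) = galois-isotopy (Group._⁻¹ galoisGroup φ)
    (trans (sym (Group.inverseˡ galoisGroup φ w))
      (Automorphism.cong (Group._⁻¹ galoisGroup φ) (sym v≈φw)))

  module AutotopismGroup {w : Carrier} (w-nd : Nondegenerate w) where

    Autotopisms : Group (c ⊔ ℓ) (c ⊔ ℓ)
    Autotopisms = autotopismGroup (mul w) (mul-cong w)

    private module G = Group Autotopisms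

    Autotopism : Set (c ⊔ ℓ)
    Autotopism = Isotopy (mul w) (mul w)

    -- For α₁ = (P , D) and α₂ = (e , Q), the first component requires e P = D Qᶜ = k with k real,
    -- the second D e = PᶜQ. Multiplying gives k² = N(P)N(Q), so P and Q determine everything.
    module Diagonal {P Q : Carrier} (P≉0 : P ≉0) (Q≉0 : Q ≉0) where

      NPNQ k D e : Carrier
      NPNQ = P * P ᶜ * (Q * Q ᶜ)
      k = proj₁ (sqrt {NPNQ} norm-product-real)
      D = k * proj₁ (inverse (≉0-ᶜ Q≉0))
      e = k * proj₁ (inverse P≉0)

      k²≈NPNQ : k * k ≈ NPNQ
      k²≈NPNQ = proj₂ (sqrt {NPNQ} norm-product-real)

      kᶜ≈k : k ᶜ ≈ k
      kᶜ≈k = square-injective (real-root k²≈NPNQ (ᶜ-cong k²≈NPNQ) norm-product-real)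

      k≉0 : k ≉0
      k≉0 k≈0 = *-≉0 (*-≉0 P≉0 (≉0-ᶜ P≉0)) (*-≉0 Q≉0 (≉0-ᶜ Q≉0))
        (trans (sym k²≈NPNQ) (trans (*-congʳ k≈0) (zeroˡ k)))

      DQᶜ≈k : D * Q ᶜ ≈ k
      DQᶜ≈k = quotient (proj₂ (inverse (≉0-ᶜ Q≉0)))

      eP≈k : e * P ≈ k
      eP≈k = quotient (proj₂ (inverse P≉0))

      D≉0 : D ≉0
      D≉0 = ≉0-*ˡ (≉0-resp (sym DQᶜ≈k) k≉0)

      e≉0 : e ≉0
      e≉0 = ≉0-*ˡ (≉0-resp (sym eP≈k) k≉0)

      De≈PᶜQ : D * e ≈ P ᶜ * Q
      De≈PᶜQ = *-cancelˡ (*-≉0 P≉0 (≉0-ᶜ Q≉0)) (diagonal-entries DQᶜ≈k eP≈k k²≈NPNQ)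

      autotopism : Autotopism
      autotopism = isotopy-by (scaleᵇ P≉0 D≉0) (scaleᵇ e≉0 Q≉0) (scaleᵇ k≉0 (*-≉0 (≉0-ᶜ P≉0) Q≉0))
        λ _ _ → diagonal₁ eP≈k DQᶜ≈k (ᶜ-cong DQᶜ≈k) kᶜ≈k , diagonal₂ De≈PᶜQ

    private
      r : Carrier
      r = 1# + w * w ᶜ

      r≉0 : r ≉0
      r≉0 p = proj₂ w-nd (sym (x+y≈0⇒x≈y p))

      r⁻¹ : Carrier
      r⁻¹ = proj₁ (inverse r≉0)

      r⁻¹ᶜ≈r⁻¹ : r⁻¹ ᶜ ≈ r⁻¹
      r⁻¹ᶜ≈r⁻¹ = *-cancelˡ r≉0
        (real-inverse (proj₂ (inverse r≉0)) (ᶜ-cong (proj₂ (inverse r≉0))) 1+norm-real)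

      ρ : Carrier
      ρ = proj₁ (sqrt {r} 1+norm-real)

      ρ²≈r : ρ * ρ ≈ r
      ρ²≈r = proj₂ (sqrt {r} 1+norm-real)

      ρ≉0 : ρ ≉0
      ρ≉0 = ≉0-*ˡ (≉0-resp (sym ρ²≈r) r≉0)

      ρᶜ≈ρ : ρ ᶜ ≈ ρ
      ρᶜ≈ρ = square-injective (real-root ρ²≈r (ᶜ-cong ρ²≈r) 1+norm-real)

      ρ⁻¹ : Carrier
      ρ⁻¹ = proj₁ (inverse ρ≉0)

      ρρ⁻¹≈1 : ρ * ρ⁻¹ ≈ 1#
      ρρ⁻¹≈1 = proj₂ (inverse ρ≉0)

    -- It rests on the identity X + w Xᶜ = a c + w (a c)ᶜ + (1 + w wᶜ) b dᶜ, valid in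
    -- characteristic 2, for X the first component of (a , b) ⋆ (c , d).
    twist : Autotopism
    twist = isotopy-by α₁ α₂ β⁻¹ λ _ _ → twist₁ ρ²≈r , twist₂ ρᶜ≈ρ
      where
      α₁ α₂ β⁻¹ : AdditiveBijection
      α₁ = additiveBijection (λ (a , b) → ρ * b , a) (λ (x , y) → y , ρ⁻¹ * x)
        (λ (p , q) → *-congˡ q , p) (λ (p , q) → q , *-congˡ p)
        (λ _ _ → distribˡ ρ _ _ , refl)
        (λ _ → scale-cancel ρρ⁻¹≈1 , refl) (λ _ → refl , scale-cancel′ ρρ⁻¹≈1)
      α₂ = additiveBijection (λ (c , d) → ρ * d ᶜ , c ᶜ) (λ (x , y) → y ᶜ , ρ⁻¹ ᶜ * x ᶜ)
        (λ (p , q) → *-congˡ (ᶜ-cong q) , ᶜ-cong p) (λ (p , q) → ᶜ-cong q , *-congˡ (ᶜ-cong p))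
        (λ _ _ → scaledᶜ-additive , ᶜ-+ _ _)
        (λ _ → ᶜ-scale-cancel ρρ⁻¹≈1 , ᶜ-involutive _)
        (λ _ → ᶜ-involutive _ , ᶜ-scale-cancel′ (ᶜ-cong ρρ⁻¹≈1))
      β⁻¹ = additiveBijection (λ (x , y) → x + w * x ᶜ , ρ * y ᶜ)
        (λ (x , y) → r⁻¹ * (x + w * x ᶜ) , ρ⁻¹ ᶜ * y ᶜ)
        (λ (p , q) → +-cong p (*-congˡ (ᶜ-cong p)) , *-congˡ (ᶜ-cong q))
        (λ (p , q) → *-congˡ (+-cong p (*-congˡ (ᶜ-cong p))) , *-congˡ (ᶜ-cong q))
        (λ _ _ → twist-additive , scaledᶜ-additive)
        (λ _ → twist-inverse r⁻¹ᶜ≈r⁻¹ (proj₂ (inverse r≉0)) , ᶜ-scale-cancel ρρ⁻¹≈1)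
        (λ _ → twist-inverse′ (proj₂ (inverse r≉0)) , ᶜ-scale-cancel′ (ᶜ-cong ρρ⁻¹≈1))

    -- With `e₁` as first argument the isotopy reads β (α₁ e₁ ⋆ α₂ z) = z, so β is the inverse of a
    -- map given by α₁ and α₂.
    α-determines-β : (I J : Autotopism) → Isotopy.α₁ I ≗ᵇ Isotopy.α₁ J →
      Isotopy.α₂ I ≗ᵇ Isotopy.α₂ J → I G.≈ J
    α-determines-β I J p q = p , q , λ z → ≋-sym (β-agree z)
      where
      module I = Isotopy I
      module J = Isotopy J
      module βI = AdditiveBijection I.β
      module βJ = AdditiveBijection J.β
      unitˡ : ∀ x → mul w e₁ x ≋ x
      unitˡ _ = IsotopyIdentities.unitˡ₁ F , IsotopyIdentities.unitˡ₂ F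
      β-agree : ∀ z → βJ.⟦_⟧ z ≋ βI.⟦_⟧ z
      β-agree z = ≋-trans
        (βJ.cong (≋-trans (≋-sym z≋) (mul-cong w (p e₁) (q (βI.⟦_⟧ z)))))
        (≋-trans (J.isotopy e₁ (βI.⟦_⟧ z)) (unitˡ _))
        where
        z≋ : mul w (⟦ I.α₁ ⟧ e₁) (⟦ I.α₂ ⟧ (βI.⟦_⟧ z)) ≋ z
        z≋ = βI.injective (≋-trans (I.isotopy e₁ (βI.⟦_⟧ z)) (unitˡ _))

    L* : Setoid (c ⊔ ℓ) ℓ
    L* = subset setoid _≉0

    Parameters : Setoid (c ⊔ ℓ) (c ⊔ ℓ)
    Parameters = ≡.setoid (Fin 2) ×ₛ (stabilizer w ×ₛ (L* ×ₛ L*))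

    power : Fin 2 → Autotopism
    power zero       = G.ε
    power (suc zero) = twist

    -- φ acts first, then the twist if chosen, then the diagonal map, as in `α₁-form`, where the
    -- matrix is applied after φ.
    realise : Setoid.Carrier Parameters → Autotopism
    realise (b , (φ , φw≈w) , (_ , P≉0) , (_ , Q≉0)) =
      (Diagonal.autotopism P≉0 Q≉0 G.∙ power b) G.∙ galois-isotopy φ (sym φw≈w)

    private
      k-cong : ∀ {P P′ Q Q′} (P≉0 : P ≉0) (P′≉0 : P′ ≉0) (Q≉0 : Q ≉0) (Q′≉0 : Q′ ≉0) →
        P ≈ P′ → Q ≈ Q′ → Diagonal.k P≉0 Q≉0 ≈ Diagonal.k P′≉0 Q′≉0
      k-cong P≉0 P′≉0 Q≉0 Q′≉0 p q = square-injective (trans (Diagonal.k²≈NPNQ P≉0 Q≉0)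
        (trans (*-cong (*-cong p (ᶜ-cong p)) (*-cong q (ᶜ-cong q))) (sym (Diagonal.k²≈NPNQ P′≉0 Q′≉0))))

      D-cong : ∀ {P P′ Q Q′} (P≉0 : P ≉0) (P′≉0 : P′ ≉0) (Q≉0 : Q ≉0) (Q′≉0 : Q′ ≉0) →
        P ≈ P′ → Q ≈ Q′ → Diagonal.D P≉0 Q≉0 ≈ Diagonal.D P′≉0 Q′≉0
      D-cong P≉0 P′≉0 Q≉0 Q′≉0 p q = *-cancelˡ (≉0-ᶜ Q≉0)
        (trans (*-comm _ _) (trans (Diagonal.DQᶜ≈k P≉0 Q≉0)
        (trans (k-cong P≉0 P′≉0 Q≉0 Q′≉0 p q) (trans (sym (Diagonal.DQᶜ≈k P′≉0 Q′≉0))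
        (trans (*-comm _ _) (*-congʳ (ᶜ-cong (sym q))))))))

      e-cong : ∀ {P P′ Q Q′} (P≉0 : P ≉0) (P′≉0 : P′ ≉0) (Q≉0 : Q ≉0) (Q′≉0 : Q′ ≉0) →
        P ≈ P′ → Q ≈ Q′ → Diagonal.e P≉0 Q≉0 ≈ Diagonal.e P′≉0 Q′≉0
      e-cong P≉0 P′≉0 Q≉0 Q′≉0 p q = *-cancelˡ P≉0
        (trans (*-comm _ _) (trans (Diagonal.eP≈k P≉0 Q≉0)
        (trans (k-cong P≉0 P′≉0 Q≉0 Q′≉0 p q) (trans (sym (Diagonal.eP≈k P′≉0 Q′≉0))
        (trans (*-comm _ _) (*-congʳ (sym p)))))))

    realise-cong : ∀ x y → Setoid._≈_ Parameters x y → realise x G.≈ realise y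
    realise-cong x@(zero , (φ , _) , (_ , P≉0) , (_ , Q≉0)) y@(_ , (ψ , _) , (_ , P′≉0) , (_ , Q′≉0))
      (≡.refl , φ≈ψ , p , q) = α-determines-β (realise x) (realise y)
        (λ _ → *-cong p (φ≈ψ _) , *-cong (D-cong P≉0 P′≉0 Q≉0 Q′≉0 p q) (φ≈ψ _))
        (λ _ → *-cong (e-cong P≉0 P′≉0 Q≉0 Q′≉0 p q) (φ≈ψ _) , *-cong q (φ≈ψ _))
    realise-cong x@(suc zero , (φ , _) , (_ , P≉0) , (_ , Q≉0)) y@(_ , (ψ , _) , (_ , P′≉0) , (_ , Q′≉0))
      (≡.refl , φ≈ψ , p , q) = α-determines-β (realise x) (realise y)
        (λ _ → *-cong p (*-congˡ (φ≈ψ _)) , *-cong (D-cong P≉0 P′≉0 Q≉0 Q′≉0 p q) (φ≈ψ _))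
        (λ _ → *-cong (e-cong P≉0 P′≉0 Q≉0 Q′≉0 p q) (*-congˡ (ᶜ-cong (φ≈ψ _))) , *-cong q (ᶜ-cong (φ≈ψ _)))

    private
      at-1 : ∀ φ x → x * Automorphism.⟦ φ ⟧ 1# ≈ x
      at-1 φ x = pick-first (Automorphism.1#-homo φ)

      at-1ᶜ : ∀ φ x → x * Automorphism.⟦ φ ⟧ 1# ᶜ ≈ x
      at-1ᶜ φ x = pick-first (trans (ᶜ-cong (Automorphism.1#-homo φ)) 1ᶜ≈1)

      at-0 : ∀ φ x y → x * (y * Automorphism.⟦ φ ⟧ 0#) ≈ 0#
      at-0 φ x y = trans (*-congˡ (trans (*-congˡ (Automorphism.0#-homo φ)) (zeroʳ y))) (zeroʳ x)

    -- The first entry of α₁ e₁ is P without the twist and 0 with it. Values at `e₁` and `e₂` then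
    -- recover P and Q, and cancelling P recovers φ.
    realise-injective : ∀ x y → realise x G.≈ realise y → Setoid._≈_ Parameters x y
    realise-injective (zero , (φ , _) , (P , P≉0) , (Q , _)) (zero , (ψ , _) , (P′ , _) , (Q′ , _))
      (p , q , _) = ≡.refl , (λ a → *-cancelˡ P≉0 (trans (proj₁ (p (a , 0#))) (*-congʳ (sym P≈P′)))) ,
        P≈P′ , trans (sym (at-1 φ Q)) (trans (proj₂ (q e₂)) (at-1 ψ Q′))
      where
      P≈P′ : P ≈ P′
      P≈P′ = trans (sym (at-1 φ P)) (trans (proj₁ (p e₁)) (at-1 ψ P′))
    realise-injective (suc zero , (φ , _) , (P , P≉0) , (Q , _)) (suc zero , (ψ , _) , (P′ , _) , (Q′ , _))
      (p , q , _) = ≡.refl ,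
        (λ a → *-cancelˡ ρ≉0 (*-cancelˡ P≉0 (trans (proj₁ (p (0# , a))) (*-congʳ (sym P≈P′))))) ,
        P≈P′ , trans (sym (at-1ᶜ φ Q)) (trans (proj₂ (q e₁)) (at-1ᶜ ψ Q′))
      where
      P≈P′ : P ≈ P′
      P≈P′ = *-cancelˡ ρ≉0 (trans (*-comm ρ P) (trans (*-congˡ (sym (at-1 φ ρ)))
        (trans (proj₁ (p e₂)) (trans (*-congˡ (at-1 ψ ρ)) (*-comm P′ ρ)))))
    realise-injective (zero , (φ , _) , (P , P≉0) , _) (suc zero , (ψ , _) , (P′ , _) , _) (p , _) =
      contradiction (trans (sym (at-1 φ P)) (trans (proj₁ (p e₁)) (at-0 ψ P′ ρ))) P≉0
    realise-injective (suc zero , (φ , _) , (P , _) , _) (zero , (ψ , _) , (P′ , P′≉0) , _) (p , _) =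
      contradiction (trans (sym (at-1 ψ P′)) (trans (sym (proj₁ (p e₁))) (at-0 φ P ρ))) P′≉0

    module Realised (I : Autotopism) where
      open Classified w-nd w-nd I
      open Matching

      private
        φw≈w : Automorphism.⟦ Φ ⟧ w ≈ w
        φw≈w = u≈w

        Φ-ᶜ : ∀ x → Automorphism.⟦ Φ ⟧ (x ᶜ) ≈ Automorphism.⟦ Φ ⟧ x ᶜ
        Φ-ᶜ = ⟦⟧-ᶜ Φ

      realised : Shape → ∃ λ x → realise x G.≈ I
      realised (diagonal B≈0 C≈0 f≈0 g≈0 A≉0 h≉0 _ Dhᶜ≈Ae) = x , α-determines-β (realise x) I
        (λ z → ≋-sym (≋-trans (α₁-form z) (keep-first B≈0 , keep-second C≈0 D≈D′)))
        (λ z → ≋-sym (≋-trans (α₂-form z) (keep-first⊙ e≈e′ f≈0 , keep-second⊙ g≈0 (ᶜ-cong (Φ-ᶜ _)))))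
        where
        x = zero , (Φ , φw≈w) , (A , A≉0) , (h , h≉0)
        module X = Diagonal A≉0 h≉0
        k≈Ae : X.k ≈ A * e
        k≈Ae = square-injective (trans X.k²≈NPNQ (sym (diagonal-root Dhᶜ≈Ae d₁)))
        D≈D′ : D ≈ X.D
        D≈D′ = *-cancelˡ (≉0-ᶜ h≉0) (trans (*-comm _ _) (trans Dhᶜ≈Ae
          (trans (sym k≈Ae) (trans (sym X.DQᶜ≈k) (*-comm _ _)))))
        e≈e′ : e ≈ X.e
        e≈e′ = *-cancelˡ A≉0 (trans (sym k≈Ae) (trans (sym X.eP≈k) (*-comm _ _)))
      realised (antidiagonal A≈0 D≈0 e≈0 h≈0 B≉0 g≉0 _ Bf≈rCgᶜ) = x , α-determines-β (realise x) I
        (λ z → ≋-sym (≋-trans (α₁-form z) (swap-first A≈0 B≈Pρ , swap-second D≈0 C≈D′)))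
        (λ z → ≋-sym (≋-trans (α₂-form z) (swap-first⊙ e≈0 e′ρ≈f (Φ-ᶜ _) , swap-second⊙ h≈0)))
        where
        P : Carrier
        -- The α₁ of the twist sends `e₂` to (ρ , 0), so B = P ρ.
        P = B * ρ⁻¹
        B≈Pρ : B ≈ P * ρ
        B≈Pρ = sym (quotient ρρ⁻¹≈1)
        P≉0 : P ≉0
        P≉0 = ≉0-*ˡ (≉0-resp B≈Pρ B≉0)
        x = suc zero , (Φ , φw≈w) , (P , P≉0) , (g , g≉0)
        module X = Diagonal P≉0 g≉0
        k≈Cgᶜ : X.k ≈ C * g ᶜ
        k≈Cgᶜ = square-injective (trans X.k²≈NPNQ (sym (*-cancelˡ (*-≉0 ρ≉0 ρ≉0)
          (antidiagonal-root {w} {ρ} {B} {C} {f} {g} {P} Bf≈rCgᶜ ρ²≈r d₂ B≈Pρ (ᶜ-cong B≈Pρ) ρᶜ≈ρ))))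
        C≈D′ : C ≈ X.D
        C≈D′ = *-cancelˡ (≉0-ᶜ g≉0) (trans (*-comm _ _)
          (trans (sym k≈Cgᶜ) (trans (sym X.DQᶜ≈k) (*-comm _ _))))
        e′ρ≈f : X.e * ρ ≈ f
        e′ρ≈f = *-cancelˡ B≉0 (antidiagonal-factor {w} Bf≈rCgᶜ ρ²≈r B≈Pρ X.eP≈k k≈Cgᶜ)

    parametrisation : Bijection Parameters G.setoid
    parametrisation = record
      { to = realise
      ; cong = λ {x} {y} → realise-cong x y
      ; bijective = (λ {x} {y} → realise-injective x y) , λ I →
          let (x , x≈) = Realised.realised I (Classified.shape w-nd w-nd I)
          in x , λ {z} z≈x → G.trans {realise z} {realise x} {I} (realise-cong z x z≈x) x≈
      }

-- Arithmetic of the field with q² elements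

module ArithmeticIdentities {c ℓ : Level} (F : ConjugationRing c ℓ) where
  open Solver
  open Soundness F

  square-additive = solve 2 (λ x y → (x + y) * ((x + y) * 1#) ≈ x * (x * 1#) + y * (y * 1#) by []) ≡.refl
  telescope = solve 5 (λ z p t t′ r → (p + t′) + (z + t) ≈ r + z by 1# · t′ + t ≈ r + p ∷ []) ≡.refl
  inverse-trace-real = solve 2 (λ w t → t ᶜ ≈ t by
    t ᶜ · (w + w ᶜ) * t ≈ 1# ∷ t · ((w + w ᶜ) * t) ᶜ ≈ 1# ᶜ ∷ []) ≡.refl
  -- When w wᶜ = 1 and t is the real inverse of w + wᶜ, the element w t has trace 1 and norm t²;
  -- this is its quadratic equation.
  artin-schreier = solve 2 (λ w t → t * t ≈ w * t * (w * t) + w * t by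
    w * t · (w + w ᶜ) * t ≈ 1# ∷ t * t · w * w ᶜ ≈ 1# ∷ []) ≡.refl
  real-root-absurd = solve 2 (λ w t → 1# ≈ 0# by
    1# · (w + w ᶜ) * t ≈ 1# ∷ 1# · (w * t) ᶜ ≈ w * t ∷ w ᶜ · t ᶜ ≈ t ∷ []) ≡.refl
  real-trace-zero = solve 2 (λ w t → 1# ≈ 0# by
    1# · (w + w ᶜ) * t ≈ 1# ∷ t · w ᶜ ≈ w ∷ []) ≡.refl

module FiniteFieldProperties {c ℓ₁ ℓ₂ : Level} (L : HeytingField c ℓ₁ ℓ₂)
  {N : ℕ} (order : HasOrder (FiniteField.setoid L) N) where

  open FiniteField L hiding (zero)

  open FiniteSetoid order public
  open HeytingField L using (tight; #⇒invertible; invertible⇒#)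
  module Π = MonoidSum *-commutativeMonoid
  module Σ = MonoidSum +-commutativeMonoid
  open Mult semiring using () renaming (_×_ to _×ₙ_; ×1-homo-* to ×ₙ1-homo-*)

  -‿≈-zero : ∀ x → x - 0# ≈ x
  -‿≈-zero x = trans (sym (+-identityʳ (x - 0#))) (trans (+-assoc x (- 0#) 0#)
    (trans (+-congˡ (-‿inverseˡ 0#)) (+-identityʳ x)))

  1≉0 : ¬ 1# ≈ 0#
  1≉0 1≈0 = proj₂ (tight 1# 0#) 1≈0
    (invertible⇒# (1# , trans (*-identityˡ _) (-‿≈-zero 1#) , trans (*-identityʳ _) (-‿≈-zero 1#)))

  -- Exhaustive search decides invertibility. An x without inverse is not apart from 0, so it is 0
  -- by tightness.
  inverse : ∀ {x} → ¬ x ≈ 0# → ∃ λ y → x * y ≈ 1#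
  inverse {x} x≉0 with any? (λ y≈z xy≈1 → trans (*-congˡ (sym y≈z)) xy≈1) (λ y → (x * y) ≟ 1#)
  ... | yes invertible = invertible
  ... | no  singular   = contradiction (proj₁ (tight x 0#) λ x#0 →
    let (y , _ , xy≈1) = #⇒invertible x#0
    in singular (y , trans (*-congʳ (sym (-‿≈-zero x))) xy≈1)) x≉0

  *-cancelˡ-0 : ∀ {x y} → ¬ x ≈ 0# → x * y ≈ 0# → y ≈ 0#
  *-cancelˡ-0 {x} {y} x≉0 xy≈0 = let (z , xz≈1) = inverse x≉0 in
    trans (sym (*-identityˡ y)) (trans (*-congʳ (trans (sym xz≈1) (*-comm x z)))
      (trans (*-assoc z x y) (trans (*-congˡ xy≈0) (zeroʳ z))))

  *-≉0 : ∀ {x y} → ¬ x ≈ 0# → ¬ y ≈ 0# → ¬ x * y ≈ 0#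
  *-≉0 x≉0 y≉0 = y≉0 ∘ *-cancelˡ-0 x≉0

  *-cancelʳ-1 : ∀ {x y} → ¬ y ≈ 0# → x * y ≈ y → x ≈ 1#
  *-cancelʳ-1 {x} {y} y≉0 xy≈y = let (z , yz≈1) = inverse y≉0 in
    trans (sym (*-identityʳ x)) (trans (*-congˡ (sym yz≈1)) (trans (sym (*-assoc x y z))
      (trans (*-congʳ xy≈y) yz≈1)))

  private
    whenZero : ∀ {x : Carrier} → Dec (x ≈ 0#) → Carrier → Carrier → Carrier
    whenZero (yes _) y z = y
    whenZero (no  _) y z = z

    Π-≉0 : ∀ {n} (t : Fin n → Carrier) → (∀ i → ¬ t i ≈ 0#) → ¬ Π.sum t ≈ 0#
    Π-≉0 {zero}  t t≉0 = 1≉0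
    Π-≉0 {suc n} t t≉0 = *-≉0 (t≉0 zero) (Π-≉0 (t ∘ suc) (t≉0 ∘ suc))

    Π-single : ∀ {n} (t : Fin n → Carrier) i → (∀ j → ¬ j ≡ i → t j ≈ 1#) → Π.sum t ≈ t i
    Π-single {suc n} t i t≈1 = trans (Π.sum-remove {i = i} t)
      (trans (*-congˡ (trans (Π.sum-cong-≋ (λ j → t≈1 (punchIn i j) (Fin.punchInᵢ≢i i j)))
        (Π.sum-replicate-zero n))) (*-identityʳ (t i)))

  -- Multiplication by x permutes the nonzero elements, so x ^ (N - 1) = 1. To stay with
  -- products over the whole field, the zero element is replaced by 1 in the product.
  fermat : ∀ x → x ^ N ≈ x
  fermat x = [x≈0?] (x ≟ 0#)
    where
    open Inverse order hiding (inverse) renaming (from to element)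

    i₀ : Fin N
    i₀ = to 0#

    element≈0⇒≡i₀ : ∀ j → element j ≈ 0# → j ≡ i₀
    element≈0⇒≡i₀ j e = ≡.trans (≡.sym (strictlyInverseˡ j)) (to-cong e)

    x^N≈x : ¬ x ≈ 0# → x ^ N ≈ x
    x^N≈x x≉0 = trans (sym (Π.sum-replicate N))
      (trans (Π.sum-cong-≋ x-splits)
      (trans (Π.∑-distrib-+ (away x ∘ element) (at x ∘ element))
      (trans (*-cong Π-away Π-at) (*-identityˡ x))))
      where
      -- x is split into a factor equal to 1 at zero and a factor equal to 1 elsewhere. Over the
      -- whole field the first has product 1 and the second contributes a single x.
      away at : Carrier → Carrier → Carrier
      away a z = whenZero (z ≟ 0#) 1# a
      at a z = whenZero (z ≟ 0#) a 1#

      nonzero : Carrier → Carrier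
      nonzero z = whenZero (z ≟ 0#) 1# z

      y = proj₁ (inverse x≉0)

      xy≈1 : x * y ≈ 1#
      xy≈1 = proj₂ (inverse x≉0)

      multiplyBy : Carrier → Fin N → Fin N
      multiplyBy a i = to (a * element i)

      undo : ∀ a b → a * b ≈ 1# → ∀ i → multiplyBy a (multiplyBy b i) ≡ i
      undo a b ab≈1 i = ≡.trans (to-cong (trans (*-congˡ (strictlyInverseʳ (b * element i)))
        (trans (sym (*-assoc a b (element i))) (trans (*-congʳ ab≈1) (*-identityˡ (element i))))))
        (strictlyInverseˡ i)

      π : Permutation.Permutation N N
      π = Permutation.permutation (multiplyBy x) (multiplyBy y)
        (undo x y xy≈1) (undo y x (trans (*-comm y x) xy≈1))

      nonzero-≉0 : ∀ z → ¬ nonzero z ≈ 0#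
      nonzero-≉0 z with z ≟ 0#
      ... | yes _   = 1≉0
      ... | no  z≉0 = z≉0

      nonzero-cong : ∀ {z z′} → z ≈ z′ → nonzero z ≈ nonzero z′
      nonzero-cong {z} {z′} e with z ≟ 0# | z′ ≟ 0#
      ... | yes _ | yes _ = refl
      ... | no  _ | no  _ = e
      ... | yes p | no  q = contradiction (trans (sym e) p) q
      ... | no  p | yes q = contradiction (trans e q) p

      nonzero-* : ∀ z → nonzero (x * z) ≈ away x z * nonzero z
      nonzero-* z with z ≟ 0# | (x * z) ≟ 0#
      ... | yes _ | yes _ = sym (*-identityˡ 1#)
      ... | no  _ | no  _ = refl
      ... | yes p | no  q = contradiction (trans (*-congˡ p) (zeroʳ x)) q
      ... | no  p | yes q = contradiction (*-cancelˡ-0 x≉0 q) p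

      Π-away : Π.sum (away x ∘ element) ≈ 1#
      Π-away = *-cancelʳ-1 (Π-≉0 (nonzero ∘ element) (nonzero-≉0 ∘ element))
        (trans (sym (Π.∑-distrib-+ (away x ∘ element) (nonzero ∘ element)))
        (trans (Π.sum-cong-≋ (λ i → sym (trans (nonzero-cong (strictlyInverseʳ (x * element i))) (nonzero-* (element i)))))
        (sym (Π.sum-permute (nonzero ∘ element) π))))

      x-splits : ∀ i → x ≈ away x (element i) * at x (element i)
      x-splits i with element i ≟ 0#
      ... | yes _ = sym (*-identityˡ x)
      ... | no  _ = sym (*-identityʳ x)

      at-i₀ : ∀ {z} → z ≈ 0# → at x z ≈ x
      at-i₀ {z} z≈0 with z ≟ 0#
      ... | yes _ = refl
      ... | no  q = contradiction z≈0 q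

      at-other : ∀ {z} → ¬ z ≈ 0# → at x z ≈ 1#
      at-other {z} z≉0 with z ≟ 0#
      ... | yes q = contradiction q z≉0
      ... | no  _ = refl

      Π-at : Π.sum (at x ∘ element) ≈ x
      Π-at = trans (Π-single (at x ∘ element) i₀ (λ j j≢i₀ → at-other (j≢i₀ ∘ element≈0⇒≡i₀ j)))
        (at-i₀ (strictlyInverseʳ 0#))

    0^m≈0 : ∀ {m} → Fin m → 0# ^ m ≈ 0#
    0^m≈0 {suc m} _ = zeroˡ _

    [x≈0?] : Dec (x ≈ 0#) → x ^ N ≈ x
    [x≈0?] (yes x≈0) = trans (^-congˡ N x≈0) (trans (0^m≈0 i₀) (sym x≈0))
    [x≈0?] (no  x≉0) = x^N≈x x≉0

  -- Adding 1 permutes the field, so the sum of all elements is unchanged when N copies of 1 are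
  -- added to it.
  N×1≈0 : N ×ₙ 1# ≈ 0#
  N×1≈0 = cancel (trans (+-congˡ (sym (Σ.sum-replicate N)))
    (trans (sym (Σ.∑-distrib-+ element (λ _ → 1#)))
    (trans (Σ.sum-cong-≋ {N} {λ i → element i + 1#} {λ i → element (shift 1# i)} (λ i → sym (strictlyInverseʳ _)))
    (sym (Σ.sum-permute element π)))))
    where
    open Inverse order hiding (inverse) renaming (from to element)
    shift : Carrier → Fin N → Fin N
    shift a i = to (element i + a)
    undo : ∀ a b → b + a ≈ 0# → ∀ i → shift a (shift b i) ≡ i
    undo a b e i = ≡.trans (to-cong (trans (+-congʳ (strictlyInverseʳ _))
      (trans (+-assoc _ b a) (trans (+-congˡ e) (+-identityʳ _))))) (strictlyInverseˡ i)
    π : Permutation.Permutation N N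
    π = Permutation.permutation (shift 1#) (shift (- 1#)) (undo 1# (- 1#) (-‿inverseˡ 1#)) (undo (- 1#) 1# (-‿inverseʳ 1#))
    cancel : ∀ {x y} → x + y ≈ x → y ≈ 0#
    cancel {x} {y} e = trans (sym (+-identityˡ y)) (trans (+-congʳ (sym (-‿inverseˡ x)))
      (trans (+-assoc (- x) x y) (trans (+-congˡ e) (-‿inverseˡ x))))

  2-power⇒1+1≈0 : ∀ k → N ≡ 2 ℕ.^ k → 1# + 1# ≈ 0#
  2-power⇒1+1≈0 k N≡2^k with (1# + 1#) ≟ 0#
  ... | yes e = e
  ... | no 2≉0 = contradiction (trans (reflexive (≡.cong (_×ₙ 1#) (≡.sym N≡2^k))) N×1≈0) (powers≉0 k)
    where
    powers≉0 : ∀ k → ¬ (2 ℕ.^ k) ×ₙ 1# ≈ 0#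
    powers≉0 zero    e = 1≉0 (trans (sym (+-identityʳ 1#)) e)
    powers≉0 (suc k) e = *-≉0 2≉0 (powers≉0 k) (trans (*-congʳ (+-congˡ (sym (+-identityʳ 1#))))
      (trans (sym (×ₙ1-homo-* 2 (2 ℕ.^ k))) e))

module QuadraticExtension {c ℓ₁ ℓ₂ : Level} (s : ℕ) (L : HeytingField c ℓ₁ ℓ₂)
  (order : HasOrder (FiniteField.setoid L) ((2 ℕ.^ ℕ.suc s) ℕ.^ 2)) where

  open FiniteField L hiding (zero; L×L; Isotopic; autotopismGroup)
  open FiniteFieldProperties L order
  open CommutativeExp commutativeSemiring using (^-distrib-*; ^-assocʳ; ^-congʳ; ^-homo-*)

  private
    q : ℕ
    q = 2 ℕ.^ ℕ.suc s

    1+1≈0 : 1# + 1# ≈ 0#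
    1+1≈0 = 2-power⇒1+1≈0 (suc s ℕ.* 2) (ℕ.^-*-assoc 2 (suc s) 2)

    1^n≈1 : ∀ n → 1# ^ n ≈ 1#
    1^n≈1 zero    = refl
    1^n≈1 (suc n) = trans (*-identityˡ _) (1^n≈1 n)

    -- The identity serves as a provisional involution: it makes the solver available for proving
    -- that the true one, the power map, is additive.
    trivialConjugation : ConjugationRing c ℓ₁
    trivialConjugation = record
      { commutativeRing = commutativeRing
      ; 1+1≈0 = 1+1≈0
      ; _ᶜ = id
      ; ᶜ-cong = id
      ; ᶜ-+ = λ _ _ → refl
      ; ᶜ-* = λ _ _ → refl
      ; 1ᶜ≈1 = refl
      ; ᶜ-involutive = λ _ → refl
      }

    module Trivial = ArithmeticIdentities trivialConjugation

    ^-suc : ∀ x k → x ^ (2 ℕ.^ suc k) ≈ (x ^ 2) ^ (2 ℕ.^ k)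
    ^-suc x k = sym (^-assocʳ x 2 (2 ℕ.^ k))

    frobenius-+ : ∀ k x y → (x + y) ^ (2 ℕ.^ k) ≈ x ^ (2 ℕ.^ k) + y ^ (2 ℕ.^ k)
    frobenius-+ zero    x y = trans (*-identityʳ _) (sym (+-cong (*-identityʳ _) (*-identityʳ _)))
    frobenius-+ (suc k) x y = trans (^-suc (x + y) k) (trans (^-congˡ (2 ℕ.^ k) Trivial.square-additive)
      (trans (frobenius-+ k (x ^ 2) (y ^ 2)) (sym (+-cong (^-suc x k) (^-suc y k)))))

    ^q-involutive : ∀ x → (x ^ q) ^ q ≈ x
    ^q-involutive x = trans (^-assocʳ x q q)
      (trans (^-congʳ x (≡.cong (q ℕ.*_) (≡.sym (ℕ.*-identityʳ q)))) (fermat x))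

  conjugationRing : ConjugationRing c ℓ₁
  conjugationRing = record
    { commutativeRing = commutativeRing
    ; 1+1≈0 = 1+1≈0
    ; _ᶜ = _^ q
    ; ᶜ-cong = ^-congˡ q
    ; ᶜ-+ = frobenius-+ (suc s)
    ; ᶜ-* = λ x y → ^-distrib-* x y q
    ; 1ᶜ≈1 = 1^n≈1 q
    ; ᶜ-involutive = ^q-involutive
    }

  conjugationField : ConjugationField c ℓ₁
  conjugationField = record
    { conjugationRing = conjugationRing
    ; _≟_ = _≟_
    ; inverse = inverse
    ; 1≉0 = 1≉0
    -- Here q = 2 ^ (s + 1), so 2 ^ s is half of q and x ^ q = x exhibits the root.
    ; sqrt = λ {x} x^q≈x → x ^ (2 ℕ.^ s) , trans (sym (^-homo-* x (2 ℕ.^ s) (2 ℕ.^ s)))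
        (trans (^-congʳ x (≡.cong (2 ℕ.^ s ℕ.+_) (≡.sym (ℕ.+-identityʳ (2 ℕ.^ s))))) x^q≈x)
    ; ⟦⟧-ᶜ = λ φ x → ⟦⟧-^ φ x q
    ; injective⇒surjective = injective⇒surjective
    }
    where
    ⟦⟧-^ : ∀ φ x n → Automorphism.⟦ φ ⟧ (x ^ n) ≈ Automorphism.⟦ φ ⟧ x ^ n
    ⟦⟧-^ φ x zero    = Automorphism.1#-homo φ
    ⟦⟧-^ φ x (suc n) = trans (Automorphism.*-homo φ x (x ^ n)) (*-congˡ (⟦⟧-^ φ x n))

  private
    open ArithmeticIdentities conjugationRing

    Tr : ℕ → Carrier → Carrier
    Tr = absoluteTrace

    Tr-cong : ∀ k {x y} → x ≈ y → Tr k x ≈ Tr k y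
    Tr-cong k x≈y = Σ.sum-cong-≋ {k} (λ i → ^-congˡ (2 ℕ.^ toℕ i) x≈y)

    Tr-+ : ∀ k x y → Tr k (x + y) ≈ Tr k x + Tr k y
    Tr-+ k x y = trans (Σ.sum-cong-≋ {k} (λ i → frobenius-+ (toℕ i) x y)) (Σ.∑-distrib-+ {k} _ _)

    Tr-suc : ∀ k x → Tr (suc k) x ≈ x + Tr k (x * x)
    Tr-suc k x = +-cong (*-identityʳ x) (Σ.sum-cong-≋ {k} (λ i →
      trans (^-suc x (toℕ i)) (^-congˡ (2 ℕ.^ toℕ i) (*-congˡ (*-identityʳ x)))))

    -- Squaring shifts the list of conjugates by one place, so everything but its two ends cancels.
    Tr-telescope : ∀ k z → Tr k (z * z) + Tr k z ≈ z ^ (2 ℕ.^ k) + z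
    Tr-telescope zero    z = trans (+-identityʳ 0#) (sym (trans (+-congʳ (*-identityʳ z))
      (ConjugationRing.x+x≈0 conjugationRing z)))
    Tr-telescope (suc k) z = trans (+-cong (Tr-suc k (z * z)) (Tr-suc k z))
      (trans (telescope (Tr-telescope k (z * z)))
      (+-congʳ (sym (trans (^-suc z k) (^-congˡ (2 ℕ.^ k) (*-congˡ (*-identityʳ z)))))))

  -- If w wᶜ = 1, then z = w t solves z² + z = t², and taking traces gives zᶜ = z.
  admissible⇒nondegenerate : ∀ {k} (K : Pred Carrier k) {w} → Admissible (suc s) K w →
    ¬ w ^ q ≈ w × ¬ w * w ^ q ≈ 1#
  admissible⇒nondegenerate _ {w} (_ , t , τt≈1 , Tr≈0) =
    (λ wᶜ≈w → 1≉0 (real-trace-zero τt≈1 wᶜ≈w)) ,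
    (λ wwᶜ≈1 → 1≉0 (real-root-absurd τt≈1 (zᶜ≈z wwᶜ≈1) tᶜ≈t))
    where
    open ConjugationRing conjugationRing using (x+y≈0⇒x≈y; x≈y⇒x+y≈0)
    tᶜ≈t : t ^ q ≈ t
    tᶜ≈t = inverse-trace-real {w} τt≈1 (^-congˡ q τt≈1)
    Tr-t²≈0 : Tr (suc s) (t * t) ≈ 0#
    Tr-t²≈0 = trans (sym (+-identityʳ _)) (trans (+-congˡ (sym Tr≈0))
      (trans (Tr-telescope (suc s) t) (x≈y⇒x+y≈0 tᶜ≈t)))
    zᶜ≈z : w * w ^ q ≈ 1# → (w * t) ^ q ≈ w * t
    zᶜ≈z wwᶜ≈1 = x+y≈0⇒x≈y (trans (sym (Tr-telescope (suc s) (w * t)))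
      (trans (sym (Tr-+ (suc s) (w * t * (w * t)) (w * t)))
      (trans (Tr-cong (suc s) (sym (artin-schreier τt≈1 wwᶜ≈1))) Tr-t²≈0)))

-- Finiteness of the stabilizer

funToFin-cong : ∀ {m n} {f g : Fin m → Fin n} → (∀ i → f i ≡ g i) → funToFin f ≡ funToFin g
funToFin-cong {zero}  f≗g = ≡.refl
funToFin-cong {suc m} f≗g = ≡.cong₂ combine (f≗g zero) (funToFin-cong (f≗g ∘ suc))

module FiniteStabilizer {c ℓ : Level} (K : ConjugationField c ℓ)
  {N : ℕ} (order : HasOrder (ConjugationField.setoid K) N) where

  open ConjugationField K hiding (_≟_)
  open Semifields K using (automorphism)
  open FiniteSetoid order using (_≟_; all?)
  open Inverse order using (to; from; to-cong; from-cong; strictlyInverseˡ; strictlyInverseʳ)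

  -- A self-map of N elements is a value table in `Fin (N ^ N)`. Membership in the image is decided
  -- by testing sums, products, 1 and w, since `automorphism` supplies bijectivity.
  stabilizer-finite : ∀ w → ∃ (HasOrder (stabilizer w))
  stabilizer-finite w = decidable-image⇒finite {S = S} code
    (λ {φ} {ψ} → code-cong {φ} {ψ}) (λ {φ} {ψ} → code-injective {φ} {ψ}) λ i →
    map′ (decode i) (decoded i) (fixing-endomorphism? i)
    where
    S : Setoid _ _
    S = stabilizer w
    module S = Setoid S

    code : S.Carrier → Fin (N ℕ.^ N)
    code (φ , _) = funToFin (λ i → to (Automorphism.⟦ φ ⟧ (from i)))

    code-cong : Congruent S._≈_ _≡_ code
    code-cong {φ} {ψ} φ≈ψ = funToFin-cong (λ i → to-cong (φ≈ψ (from i)))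

    apply : Fin (N ℕ.^ N) → Carrier → Carrier
    apply i x = from (finToFun i (to x))

    apply-cong : ∀ i {x y} → x ≈ y → apply i x ≈ apply i y
    apply-cong i x≈y = from-cong (≡.cong (finToFun i) (to-cong x≈y))

    apply-code : ∀ φ x → apply (code φ) x ≈ Automorphism.⟦ proj₁ φ ⟧ x
    apply-code (φ , _) x = trans (from-cong (Fin.finToFun-funToFin _ (to x)))
      (trans (strictlyInverseʳ _) (Automorphism.cong φ (strictlyInverseʳ x)))

    code-injective : Injective S._≈_ _≡_ code
    code-injective {φ} {ψ} e x = trans (sym (apply-code φ x))
      (trans (reflexive (≡.cong (λ i → apply i x) e)) (apply-code ψ x))

    FixingEndomorphism : (Carrier → Carrier) → Set _
    FixingEndomorphism f = (∀ x y → f (x + y) ≈ f x + f y) × (∀ x y → f (x * y) ≈ f x * f y) ×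
      f 1# ≈ 1# × f w ≈ w

    fixing-endomorphism? : ∀ i → Dec (FixingEndomorphism (apply i))
    fixing-endomorphism? i =
      preserves? +-cong ×-dec preserves? *-cong ×-dec (f 1# ≟ 1#) ×-dec (f w ≟ w)
      where
      f : Carrier → Carrier
      f = apply i
      preserves? : ∀ {_∙_ : Carrier → Carrier → Carrier} →
        (∀ {x x′ y y′} → x ≈ x′ → y ≈ y′ → (x ∙ y) ≈ (x′ ∙ y′)) → Dec (∀ x y → f (x ∙ y) ≈ (f x ∙ f y))
      preserves? {_∙_} ∙-cong = all? (λ x≈x′ e y → resp x≈x′ refl (e y)) λ x →
        all? (resp refl) (λ y → f (x ∙ y) ≟ (f x ∙ f y))
        where
        resp : ∀ {x x′ y y′} → x ≈ x′ → y ≈ y′ → f (x ∙ y) ≈ (f x ∙ f y) → f (x′ ∙ y′) ≈ (f x′ ∙ f y′)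
        resp p q e = trans (apply-cong i (sym (∙-cong p q))) (trans e (∙-cong (apply-cong i p) (apply-cong i q)))

    decode : ∀ i → FixingEndomorphism (apply i) → ∃ λ φ → code φ ≡ i
    decode i (f-+ , f-* , f-1 , f-w) =
      (automorphism (apply i) (apply-cong i) f-+ f-* f-1 , f-w) ,
      ≡.trans (funToFin-cong (λ j → ≡.trans (strictlyInverseˡ _) (≡.cong (finToFun i) (strictlyInverseˡ j))))
        (Fin.funToFin-finToFin {N} {N} i)

    decoded : ∀ i → (∃ λ φ → code φ ≡ i) → FixingEndomorphism (apply i)
    decoded _ (φ@(f , fw≈w) , ≡.refl) =
      (λ x y → trans (≈f _) (trans (f.+-homo x y) (sym (+-cong (≈f x) (≈f y))))) ,
      (λ x y → trans (≈f _) (trans (f.*-homo x y) (sym (*-cong (≈f x) (≈f y))))) ,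
      trans (≈f 1#) f.1#-homo , trans (≈f w) fw≈w
      where
      module f = Automorphism f
      ≈f : ∀ x → apply (code φ) x ≈ f.⟦_⟧ x
      ≈f = apply-code φ

-- Assembling the classification and the order

open import Data.Nat.Base using (_≤_; _*_; _^_; _∸_)

theorem6 : {c ℓ₁ ℓ₂ ℓ₃ : Level} (s : ℕ) → 1 ≤ s →
    (L : HeytingField c ℓ₁ ℓ₂) →
    let module L = FiniteField L
        q = 2 ^ s
    in
    HasOrder L.setoid (q ^ 2) →
    (K : Pred L.Carrier ℓ₃) → L.IsSubfield K → HasOrder (subset L.setoid K) q →
    (∀ w v → L.Admissible s K w → L.Admissible s K v →
      L.Isotopic (L.B q w) (L.B q v) ⇔ (∃ λ φ → v L.≈ L.Automorphism.⟦ φ ⟧ w))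
    ×
    (∀ w → L.Admissible s K w →
      ∃ λ ι → HasOrder (L.stabilizer w) ι ×
              HasOrder (Group.setoid (L.Autotopisms q w)) (2 * ι * (q ^ 2 ∸ 1) ^ 2))
theorem6 (suc s) _ L order K _ _ =
  (λ w v w-adm v-adm → mk⇔
    (isotopic⇒conjugate {w} {v} (admissible⇒nondegenerate K w-adm) (admissible⇒nondegenerate K v-adm))
    conjugate⇒isotopic) ,
  λ w w-adm →
    let open AutotopismGroup {w} (admissible⇒nondegenerate K w-adm)
        (ι , ι-order) = FiniteStabilizer.stabilizer-finite conjugationField order w
        m = (2 ^ suc s) ^ 2 ∸ 1
        L*-order = order-without order (FiniteField.0# L)
    in ι , ι-order , ≡.subst (HasOrder (Group.setoid Autotopisms)) (count ι m)
      (Compose.inverse (Symmetry.inverse (Bijection⇒Inverse parametrisation))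
        (order-× (Identity.inverse (≡.setoid (Fin 2)))
          (order-× ι-order (order-× L*-order L*-order))))
  where
  open QuadraticExtension s L order using (conjugationField; admissible⇒nondegenerate)
  open Autotopy conjugationField
  count : ∀ ι m → 2 * (ι * (m * m)) ≡ 2 * ι * m ^ 2
  count ι m = ≡.trans (≡.sym (ℕ.*-assoc 2 ι (m * m)))
    (≡.cong (λ n → 2 * ι * (m * n)) (≡.sym (ℕ.*-identityʳ m)))
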